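{- Let $\mathcal{C}$ be a flag code of type $(t_1,\dots,t_r)$ on $\mathbb{F}_q^n$ and let $a=\max\{i\in\{1,\dots,r\}\mid 2t_i\leq n\}$ and $b=\min\{i\in\{1,\dots,r\}\mid 2t_i\geq n\}$. The following are equivalent: (i) $\mathcal{C}$ is an optimum distance flag code; (ii) $\mathcal{C}_a$ and $\mathcal{C}_b$ are constant dimension codes of maximum distance with $|\mathcal{C}_a|=|\mathcal{C}_b|=|\mathcal{C}|$.
   Context: $d_S(\mathcal{U},\mathcal{V})=\dim(\mathcal{U}+\mathcal{V})-\dim(\mathcal{U}\cap\mathcal{V})$ for subspaces of $\mathbb{F}_q^n$. A constant dimension code is a nonempty set $\mathcal{C}$ of $k$-dimensional subspaces of $\mathbb{F}_q^n$, with minimum distance $d_S(\mathcal{C})$ the least distance between distinct elements ($0$ if $|\mathcal{C}|=1$); it has maximum distance if $d_S(\mathcal{C})=2k$ when $2k\leq n$ and $d_S(\mathcal{C})=2(n-k)$ when $2k\geq n$. For $0<t_1<\dots<t_r<n$, a flag of type $(t_1,\dots,t_r)$ is a chain $\mathcal{F}_1\subsetneq\cdots\subsetneq\mathcal{F}_r$ of subspaces of $\mathbb{F}_q^n$ with $\dim\mathcal{F}_i=t_i$. A flag code is a nonempty set $\mathcal{C}$ of flags of a fixed type; the flag distance is $d_f(\mathcal{F},\mathcal{F}')=\sum_i d_S(\mathcal{F}_i,\mathcal{F}'_i)$, $d_f(\mathcal{C})$ is the minimum flag distance between distinct flags of $\mathcal{C}$ ($0$ if $|\mathcal{C}|=1$),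 and the $i$-th projected code is $\mathcal{C}_i=\{\mathcal{F}_i\mid\mathcal{F}\in\mathcal{C}\}$. $\mathcal{C}$ is an optimum distance flag code (ODFC) if $d_f(\mathcal{C})=2\left(\sum_{2t_i\leq n}t_i+\sum_{2t_i>n}(n-t_i)\right)$. At least one of the indices $a,b$ exists; if one of them does not exist (the defining set is empty), all conditions referring to it are omitted. -}

module Defs where

open import Level using (Level; _⊔_) renaming (suc to lsuc)
open import Algebra.Bundles using (CommutativeRing)
open import Data.Nat as ℕ using (ℕ; zero; suc; _∸_; _≤_; _<_; _≤?_)
open import Data.Fin as Fin using (Fin)
open import Data.Vec as Vec using (Vec; []; _∷_; lookup; zipWith; replicate)
open import Data.List as List using (List; []; _∷_; length)
open import Data.List.Relation.Unary.All using (All)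
open import Data.List.Relation.Unary.Any using (Any)
open import Data.List.Relation.Unary.AllPairs using (AllPairs)
open import Data.List.Membership.Propositional using (_∈_)
open import Data.Product using (Σ; ∃; ∃₂; _×_; _,_)
open import Data.Sum using (_⊎_)
open import Relation.Nullary using (¬_; yes; no)
open import Relation.Binary.PropositionalEquality using (_≡_)

record FiniteField (c ℓ : Level) : Set (lsuc (c ⊔ ℓ)) where
  field
    commRing    : CommutativeRing c ℓ
  open CommutativeRing commRing public
  field
    1≉0         : ¬ (1# ≈ 0#)
    inverse     : ∀ x → ¬ (x ≈ 0#) → ∃ λ y → (x * y) ≈ 1#
    elements    : List Carrier
    complete    : ∀ x → Any (x ≈_) elements

module _ {c ℓ : Level} (F : FiniteField c ℓ) where
  open FiniteField F

  V : ℕ → Set c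
  V n = Vec Carrier n

  _≈v_ : ∀ {n} → V n → V n → Set ℓ
  u ≈v v = ∀ i → lookup u i ≈ lookup v i

  _+v_ : ∀ {n} → V n → V n → V n
  _+v_ = zipWith _+_

  _·v_ : ∀ {n} → Carrier → V n → V n
  a ·v v = Vec.map (a *_) v

  0v : ∀ {n} → V n
  0v = replicate _ 0#

  lincomb : ∀ {n} (vs : List (V n)) → Vec Carrier (length vs) → V n
  lincomb []       []       = 0v
  lincomb (v ∷ vs) (a ∷ as) = (a ·v v) +v lincomb vs as

  LinIndep : ∀ {n} → List (V n) → Set (c ⊔ ℓ)
  LinIndep vs = ∀ as → lincomb vs as ≈v 0v → ∀ j → lookup as j ≈ 0#

  VSet : ℕ → Set (lsuc (c ⊔ ℓ))
  VSet n = V n → Set (c ⊔ ℓ)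

  IsBasis : ∀ {n} → VSet n → List (V n) → Set (c ⊔ ℓ)
  IsBasis P vs = All P vs × LinIndep vs
               × (∀ v → P v → ∃ λ as → lincomb vs as ≈v v)

  HasDim : ∀ {n} → VSet n → ℕ → Set (c ⊔ ℓ)
  HasDim P k = ∃ λ vs → length vs ≡ k × IsBasis P vs

  record Subspace (n : ℕ) : Set (lsuc (c ⊔ ℓ)) where
    field
      mem    : VSet n
      resp   : ∀ {u v} → u ≈v v → mem u → mem v
      0∈     : mem 0v
      +∈     : ∀ {u v} → mem u → mem v → mem (u +v v)
      ·∈     : ∀ a {v} → mem v → mem (a ·v v)
  open Subspace public

  _≅_ : ∀ {n} → Subspace n → Subspace n → Set (c ⊔ ℓ)
  U ≅ W = ∀ v → (mem U v → mem W v) × (mem W v → mem U v)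

  _⊆_ : ∀ {n} → Subspace n → Subspace n → Set (c ⊔ ℓ)
  U ⊆ W = ∀ v → mem U v → mem W v

  _⊊_ : ∀ {n} → Subspace n → Subspace n → Set (c ⊔ ℓ)
  U ⊊ W = U ⊆ W × ¬ (U ≅ W)

  sumS : ∀ {n} → Subspace n → Subspace n → VSet n
  sumS U W v = ∃₂ λ u w → mem U u × mem W w × v ≈v (u +v w)

  capS : ∀ {n} → Subspace n → Subspace n → VSet n
  capS U W v = mem U v × mem W v

  DistS : ∀ {n} → Subspace n → Subspace n → ℕ → Set (c ⊔ ℓ)
  DistS U W d = ∃₂ λ s i → HasDim (sumS U W) s × HasDim (capS U W) i × d ≡ s ∸ i

module _ {a e : Level} {A : Set a} where

  HasCard : (A → A → Set e) → List A → ℕ → Set (a ⊔ e)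
  HasCard _≅_ L m = ∃ λ xs → length xs ≡ m
                  × All (λ x → Any (x ≅_) L) xs
                  × All (λ y → Any (y ≅_) xs) L
                  × AllPairs (λ x y → ¬ (x ≅ y)) xs

  MinDist : (A → A → Set e) → (A → A → ℕ → Set e) → List A → ℕ → Set (a ⊔ e)
  MinDist _≅_ D L d =
      (∀ {x y} → x ∈ L → y ∈ L → ¬ (x ≅ y) → ∀ d' → D x y d' → d ≤ d')
    × ( (HasCard _≅_ L 1 × d ≡ 0)
      ⊎ (∃₂ λ x y → x ∈ L × y ∈ L × ¬ (x ≅ y) × D x y d))

module _ {c ℓ : Level} (F : FiniteField c ℓ) where

  IsCDC : ∀ {n} → List (Subspace F n) → ℕ → Set (lsuc (c ⊔ ℓ))
  IsCDC L k = ¬ (L ≡ []) × All (λ U → HasDim F (mem U) k) L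

  MaxDistCDC : (n : ℕ) → List (Subspace F n) → ℕ → Set (lsuc (c ⊔ ℓ))
  MaxDistCDC n L k =
      (2 ℕ.* k ≤ n → MinDist (_≅_ F) (DistS F) L (2 ℕ.* k))
    × (n ≤ 2 ℕ.* k → MinDist (_≅_ F) (DistS F) L (2 ℕ.* (n ∸ k)))

ΣFin : (r : ℕ) → (Fin r → ℕ) → ℕ
ΣFin zero    f = 0
ΣFin (suc r) f = f Fin.zero ℕ.+ ΣFin r (λ i → f (Fin.suc i))

IsType : (n r : ℕ) → (Fin r → ℕ) → Set
IsType n r t = (∀ i → 0 < t i) × (∀ i → t i < n)
             × (∀ i j → i Fin.< j → t i < t j)

optTerm : ℕ → ℕ → ℕ
optTerm n ti with 2 ℕ.* ti ≤? n
... | yes _ = ti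
... | no  _ = n ∸ ti

optDist : (n r : ℕ) → (Fin r → ℕ) → ℕ
optDist n r t = 2 ℕ.* ΣFin r (λ i → optTerm n (t i))

module _ {c ℓ : Level} (F : FiniteField c ℓ) where

  record Flag (n r : ℕ) (t : Fin r → ℕ) : Set (lsuc (c ⊔ ℓ)) where
    field
      sub   : Fin r → Subspace F n
      dim   : ∀ i → HasDim F (mem (sub i)) (t i)
      chain : ∀ i j → i Fin.< j → _⊊_ F (sub i) (sub j)
  open Flag public

  FlagEq : ∀ {n r t} → Flag n r t → Flag n r t → Set (c ⊔ ℓ)
  FlagEq Φ Ψ = ∀ i → _≅_ F (sub Φ i) (sub Ψ i)

  FlagDist : ∀ {n r t} → Flag n r t → Flag n r t → ℕ → Set (c ⊔ ℓ)
  FlagDist {r = r} Φ Ψ d = ∃ λ (ds : Fin r → ℕ) →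
    (∀ i → DistS F (sub Φ i) (sub Ψ i) (ds i)) × d ≡ ΣFin r ds

  -- a flag code: a nonempty list of pairwise distinct flags
  -- (so its cardinality |C| is length C)
  IsFlagCode : ∀ {n r t} → List (Flag n r t) → Set (lsuc (c ⊔ ℓ))
  IsFlagCode C = ¬ (C ≡ []) × AllPairs (λ Φ Ψ → ¬ FlagEq Φ Ψ) C

  -- i-th projected code C_i (as a list; as a set, up to ≅)
  proj : ∀ {n r t} → List (Flag n r t) → Fin r → List (Subspace F n)
  proj C i = List.map (λ Φ → sub Φ i) C

  IsODFC : (n r : ℕ) (t : Fin r → ℕ) → List (Flag n r t) → Set (lsuc (c ⊔ ℓ))
  IsODFC n r t C = MinDist FlagEq FlagDist C (optDist n r t)

IsMaxLe : (n r : ℕ) → (Fin r → ℕ) → Fin r → Set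
IsMaxLe n r t a = 2 ℕ.* t a ≤ n × (∀ i → 2 ℕ.* t i ≤ n → i Fin.≤ a)

IsMinGe : (n r : ℕ) → (Fin r → ℕ) → Fin r → Set
IsMinGe n r t b = n ≤ 2 ℕ.* t b × (∀ i → n ≤ 2 ℕ.* t i → b Fin.≤ i)

{-# OPTIONS --safe #-}
module Submission where

-- Per index i, the subspace distance is at most 2 optTerm(tᵢ), so a flag distance is optimal iff
-- the distance at every index is.  If 2tᵢ ≤ n this means that the two subspaces meet trivially,
-- a property that descends to all smaller indices; if 2tᵢ ≥ n it means that they span the whole
-- space, a property that ascends to all larger indices.  Hence the indices a and b decide.
--
-- Equality in F is not decidable, since the list of its elements may contain repetitions that
-- cannot be recognised.  Inequalities between numbers are ¬¬-stable, so for these one may argue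
-- classically.  The bases needed to attain the optimal distance are explicit: an injective
-- endomorphism of F^n is surjective because its orbits are periodic, and the kernel of a
-- surjection F^m → F^n is free because F has stable range one.

open import Defs
open import Level using (Level; _⊔_)
open import Data.Nat as ℕ using (ℕ; zero; suc; _≤_; _<_; _∸_; s≤s; z≤n)
import Data.Nat.Properties as ℕₚ
open import Data.Nat.Tactic.RingSolver using (solve-∀)
open import Data.Nat.GeneralisedArithmetic using (fold; fold-+)
open import Data.Fin as Fin using (Fin; zero; suc; splitAt; join; funToFin; finToFun)
import Data.Fin.Properties as Finₚ
open import Data.Vec as Vec using (Vec; []; _∷_; lookup; tabulate)
import Data.Vec.Properties as Vecₚ
open import Data.List as List using (List; []; _∷_; length)
open import Data.List.Relation.Unary.All as All using (All; []; _∷_)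
open import Data.List.Relation.Unary.Any as Any using (Any; here; there)
open import Data.List.Relation.Unary.AllPairs using (AllPairs; []; _∷_)
import Data.List.Relation.Unary.All.Properties as Allₚ
import Data.List.Relation.Unary.AllPairs.Properties as AllPairsₚ
import Data.List.Properties as Listₚ
open import Data.List.Membership.Propositional using (_∈_)
open import Data.List.Membership.Propositional.Properties using (∈-lookup; ∈-map⁺; ∈-map⁻)
import Data.List.Relation.Unary.Any.Properties as Anyₚ
open import Data.Product using (∃; ∃₂; _×_; _,_; proj₁; proj₂)
open import Data.Sum using (_⊎_; inj₁; inj₂; [_,_]′)
open import Data.Empty using (⊥-elim)
open import Data.Unit using (⊤; tt)
open import Function using (_∘_; id)
open import Function.Bundles using (_⇔_; mk⇔)
open import Relation.Nullary using (¬_; Dec; yes; no)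
open import Relation.Nullary.Decidable using (decidable-stable; ¬¬-excluded-middle)
open import Relation.Nullary.Negation using (¬¬-map; ¬¬-Monad)
open import Relation.Binary.PropositionalEquality as ≡ using (_≡_; _≢_)

-- Periodic orbits of self-maps of a finite set

module _ {c ℓ : Level} {X : Set c} (_~_ : X → X → Set ℓ) {N : ℕ}
         (code : X → Fin N) (sound : ∀ {x y} → code x ≡ code y → x ~ y)
         (f : X → X) where

  -- Pigeonhole on the codes of the first `N + 1` iterates. Only `sound` is available: equivalent
  -- elements may carry different codes, so an enumeration with repetitions will do. The extra `f`
  -- in front of `fold x f d` makes the period `1 + d` positive.
  orbit-recurs : ∀ x → ∃₂ λ i d → fold x f i ~ fold (f (fold x f d)) f i
  orbit-recurs x with Finₚ.pigeonhole (ℕₚ.n<1+n N) (λ i → code (fold x f (Fin.toℕ i)))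
  ... | i , j , i<j , eq with ℕₚ.m≤n⇒∃[o]m+o≡n i<j
  ...   | d , 1+i+d≡j = Fin.toℕ i , d , ≡.subst (fold x f (Fin.toℕ i) ~_)
            (≡.trans (≡.cong (fold x f) (≡.trans (≡.sym 1+i+d≡j) (≡.sym (ℕₚ.+-suc (Fin.toℕ i) d))))
                     (fold-+ x f (Fin.toℕ i)))
            (sound eq)

  fold-cancel : (∀ {x y} → f x ~ f y → x ~ y) → ∀ i {x y} → fold x f i ~ fold y f i → x ~ y
  fold-cancel inj zero    e = e
  fold-cancel inj (suc i) e = fold-cancel inj i (inj e)

  -- The `i` common applications of `f` in the recurrence cancel, which leaves a purely periodic
  -- orbit; `fold x f d` is then a preimage of `x`.
  injective⇒periodic : (∀ {x y} → f x ~ f y → x ~ y) → ∀ x → ∃ λ d → x ~ f (fold x f d)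
  injective⇒periodic inj x with orbit-recurs x
  ... | i , d , e = d , fold-cancel inj i e

-- Arithmetic with truncated subtraction

m+m≡2*m : ∀ m → m ℕ.+ m ≡ 2 ℕ.* m
m+m≡2*m m = ≡.cong (m ℕ.+_) (≡.sym (ℕₚ.+-identityʳ m))

-- Numerical side of the dimension formula, for `s` the dimension of a sum and `i` that of the
-- intersection. Writing `s` as `t + p`, the second hypothesis says `t ≤ p + i`, so `s ≤ 2p + i`.
s∸i≤2[s∸t] : ∀ {s i t} → t ≤ s → t ℕ.+ t ≤ s ℕ.+ i → s ∸ i ≤ 2 ℕ.* (s ∸ t)
s∸i≤2[s∸t] {s} {i} {t} t≤s 2t≤s+i with ℕₚ.m≤n⇒∃[o]m+o≡n t≤s
... | p , ≡.refl = begin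
  (t ℕ.+ p) ∸ i         ≤⟨ ℕₚ.∸-monoˡ-≤ i (ℕₚ.+-monoˡ-≤ p t≤p+i) ⟩
  (p ℕ.+ i ℕ.+ p) ∸ i   ≡⟨ ≡.cong (_∸ i) (swap p i) ⟩
  (2 ℕ.* p ℕ.+ i) ∸ i   ≡⟨ ℕₚ.m+n∸n≡m (2 ℕ.* p) i ⟩
  2 ℕ.* p               ≡⟨ ≡.cong (2 ℕ.*_) (ℕₚ.m+n∸m≡n t p) ⟨
  2 ℕ.* ((t ℕ.+ p) ∸ t) ∎
  where
  open ℕₚ.≤-Reasoning
  t≤p+i : t ≤ p ℕ.+ i
  t≤p+i = ℕₚ.+-cancelˡ-≤ t t (p ℕ.+ i) (≡.subst (t ℕ.+ t ≤_) (ℕₚ.+-assoc t p i) 2t≤s+i)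
  swap : ∀ p i → p ℕ.+ i ℕ.+ p ≡ 2 ℕ.* p ℕ.+ i
  swap = solve-∀

-- The distance when the sum is the whole space and the intersection has dimension `k`: with `n`
-- written as `t + m`, cancelling `t` gives `t ≡ m + k`.
2[n∸t]≡n∸k : ∀ {n t k} → t ≤ n → t ℕ.+ t ≡ n ℕ.+ k → 2 ℕ.* (n ∸ t) ≡ n ∸ k
2[n∸t]≡n∸k {n} {t} {k} t≤n 2t≡n+k with ℕₚ.m≤n⇒∃[o]m+o≡n t≤n
... | m , ≡.refl = begin
  2 ℕ.* ((t ℕ.+ m) ∸ t) ≡⟨ ≡.cong (2 ℕ.*_) (ℕₚ.m+n∸m≡n t m) ⟩
  2 ℕ.* m               ≡⟨ ℕₚ.m+n∸n≡m (2 ℕ.* m) k ⟨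
  (2 ℕ.* m ℕ.+ k) ∸ k   ≡⟨ ≡.cong (_∸ k) (swap m k) ⟩
  (m ℕ.+ k ℕ.+ m) ∸ k   ≡⟨ ≡.cong (λ t → (t ℕ.+ m) ∸ k) t≡m+k ⟨
  (t ℕ.+ m) ∸ k         ∎
  where
  open ≡.≡-Reasoning
  t≡m+k : t ≡ m ℕ.+ k
  t≡m+k = ℕₚ.+-cancelˡ-≡ t t (m ℕ.+ k) (≡.trans 2t≡n+k (ℕₚ.+-assoc t m k))
  swap : ∀ m k → 2 ℕ.* m ℕ.+ k ≡ m ℕ.+ k ℕ.+ m
  swap = solve-∀

∸-reflectsˡ-≤ : ∀ {m n o} → o ≤ n → m ∸ o ≤ n ∸ o → m ≤ n
∸-reflectsˡ-≤ {m} {n} {o} o≤n le = begin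
  m              ≤⟨ ℕₚ.m≤n+m∸n m o ⟩
  o ℕ.+ (m ∸ o)  ≤⟨ ℕₚ.+-monoʳ-≤ o le ⟩
  o ℕ.+ (n ∸ o)  ≡⟨ ℕₚ.m+[n∸m]≡n o≤n ⟩
  n              ∎
  where open ℕₚ.≤-Reasoning

-- Positivity of `t` guards against truncation: it makes `s ∸ i` positive, hence `i ≤ s`, and then
-- `i + 2 * t ≤ s ≤ 2 * t`.
2t≤s∸i⇒i≡0 : ∀ {s i t} → 0 < t → s ≤ t ℕ.+ t → 2 ℕ.* t ≤ s ∸ i → i ≡ 0
2t≤s∸i⇒i≡0 {s} {i} {t} 0<t s≤2t 2t≤s∸i = ℕₚ.n≤0⇒n≡0 (ℕₚ.+-cancelʳ-≤ (2 ℕ.* t) i 0 (begin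
  i ℕ.+ 2 ℕ.* t    ≤⟨ ℕₚ.+-monoʳ-≤ i 2t≤s∸i ⟩
  i ℕ.+ (s ∸ i)    ≡⟨ ℕₚ.m+[n∸m]≡n i≤s ⟩
  s                ≤⟨ s≤2t ⟩
  t ℕ.+ t          ≡⟨ m+m≡2*m t ⟩
  2 ℕ.* t          ∎))
  where
  open ℕₚ.≤-Reasoning
  0<2t : 0 < 2 ℕ.* t
  0<2t = ℕₚ.≤-trans 0<t (ℕₚ.m≤m+n t _)
  i≤s : i ≤ s
  i≤s with ℕₚ.≤-total i s
  ... | inj₁ i≤s = i≤s
  ... | inj₂ s≤i = ⊥-elim (ℕₚ.<⇒≱ 0<2t (ℕₚ.≤-trans 2t≤s∸i (ℕₚ.≤-reflexive (ℕₚ.m≤n⇒m∸n≡0 s≤i))))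

-- Finite fields: enumeration and classical reasoning

module LinearAlgebra {c ℓ : Level} (F : FiniteField c ℓ) where
  open FiniteField F hiding (zero)
  open import Algebra.Properties.Ring ring
  open import Algebra.Solver.Ring.NaturalCoefficients.Default commutativeSemiring
    using (solve; _:+_; _:*_; _:=_)
  open import Relation.Binary.Reasoning.Setoid setoid

  *-cancelˡ-inverse : ∀ {a b x y} → a * b ≈ 1# → a * x ≈ a * y → x ≈ y
  *-cancelˡ-inverse {a} {b} {x} {y} ab≈1 ax≈ay = begin
    x            ≈⟨ sym (*-identityˡ x) ⟩
    1# * x       ≈⟨ *-congʳ (sym ab≈1) ⟩
    a * b * x    ≈⟨ solve 3 (λ a b x → a :* b :* x := b :* (a :* x)) refl a b x ⟩
    b * (a * x)  ≈⟨ *-congˡ ax≈ay ⟩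
    b * (a * y)  ≈⟨ solve 3 (λ a b y → b :* (a :* y) := a :* b :* y) refl a b y ⟩
    a * b * y    ≈⟨ *-congʳ ab≈1 ⟩
    1# * y       ≈⟨ *-identityˡ y ⟩
    y            ∎

  q : ℕ
  q = length elements

  index : Carrier → Fin q
  index x = Any.index (complete x)

  element : Fin q → Carrier
  element = List.lookup elements

  element-index : ∀ x → x ≈ element (index x)
  element-index x = Anyₚ.lookup-index (complete x)

  index-sound : ∀ {x y} → index x ≡ index y → x ≈ y
  index-sound {x} {y} e = trans (element-index x) (trans (reflexive (≡.cong element e)) (sym (element-index y)))

  -- The witness is a power a ^ (1 + d) with a ^ i ≈ a ^ (i + 1 + d); it replaces the undecidable
  -- case distinction between a ≈ 0# and a invertible.
  invertibilityIndicator : ∀ a → ∃ λ e → (a ≈ 0# → e ≈ 0#) × (¬ a ≈ 0# → e ≈ 1#)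
  invertibilityIndicator a with orbit-recurs _≈_ index index-sound (a *_) 1#
  ... | i , d , e = a * fold 1# (a *_) d
      , (λ a≈0 → trans (*-congʳ a≈0) (zeroˡ _))
      , (λ a≉0 → sym (fold-cancel _≈_ index index-sound (a *_)
                        (*-cancelˡ-inverse (proj₂ (inverse a a≉0))) i e))

  ¬¬-all : ∀ {a m} {P : Fin m → Set a} → (∀ i → ¬ ¬ P i) → ¬ ¬ (∀ i → P i)
  ¬¬-all = Finₚ.sequence (RawMonad.rawApplicative ¬¬-Monad)
    where open import Effect.Monad using (module RawMonad)

  -- Only the finitely many listed elements need a zero test, so the double negations of excluded
  -- middle can be collected; every other element inherits the test of its listed representative.
  ¬¬-decidable : ¬ ¬ (∀ x → Dec (x ≈ 0#))
  ¬¬-decidable = ¬¬-map transfer (¬¬-all {m = q} λ i → ¬¬-excluded-middle)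
    where
    transfer : (∀ i → Dec (element i ≈ 0#)) → ∀ x → Dec (x ≈ 0#)
    transfer d x with d (index x)
    ... | yes e = yes (trans (element-index x) e)
    ... | no ne = no λ e → ne (trans (sym (element-index x)) e)

  -- Vectors as functions, and linear maps

  -- The index type is arbitrary, so that a direct sum is indexed by a disjoint union and its
  -- projections are instances of `reindex`.
  Fn : Set → Set c
  Fn I = I → Carrier

  infix 4 _≋_
  _≋_ : {I : Set} → Fn I → Fn I → Set ℓ
  x ≋ y = ∀ i → x i ≈ y i

  0f : {I : Set} → Fn I
  0f _ = 0#

  infixl 6 _+f_
  _+f_ : {I : Set} → Fn I → Fn I → Fn I
  (x +f y) i = x i + y i

  infixl 7 _*f_
  _*f_ : {I : Set} → Carrier → Fn I → Fn I
  (a *f x) i = a * x i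

  -f_ : {I : Set} → Fn I → Fn I
  (-f x) i = - x i

  codeFn : ∀ {n} → Fn (Fin n) → Fin (q ℕ.^ n)
  codeFn x = funToFin (index ∘ x)

  decodeFn : ∀ {n} → Fin (q ℕ.^ n) → Fn (Fin n)
  decodeFn {n} k = element ∘ finToFun {q} {n} k

  decode-code : ∀ {n} (x : Fn (Fin n)) → x ≋ decodeFn (codeFn x)
  decode-code x i = trans (element-index (x i))
    (reflexive (≡.cong element (≡.sym (Finₚ.finToFun-funToFin (index ∘ x) i))))

  codeFn-sound : ∀ {n} {x y : Fn (Fin n)} → codeFn x ≡ codeFn y → x ≋ y
  codeFn-sound {n} {x} {y} e i = trans (decode-code x i)
    (trans (reflexive (≡.cong (λ k → decodeFn {n} k i) e)) (sym (decode-code y i)))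

  record Linear (I J : Set) : Set (c ⊔ ℓ) where
    field
      app   : Fn I → Fn J
      resp≋ : ∀ {x y} → x ≋ y → app x ≋ app y
      add   : ∀ x y → app (x +f y) ≋ app x +f app y
      scale : ∀ a x → app (a *f x) ≋ a *f app x

    app-0 : app 0f ≋ 0f
    app-0 j = trans (resp≋ (λ i → sym (zeroˡ 0#)) j) (trans (scale 0# 0f j) (zeroˡ _))

    app-neg : ∀ x → app (-f x) ≋ -f app x
    app-neg x j = trans (resp≋ (λ i → sym (-1*x≈-x (x i))) j)
      (trans (scale (- 1#) x j) (-1*x≈-x _))

    app-sub : ∀ x y → app (x +f (-f y)) ≋ app x +f (-f app y)
    app-sub x y j = trans (add x (-f y) j) (+-congˡ (app-neg y j))

    ≋0 : ∀ {x} → x ≋ 0f → app x ≋ 0f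
    ≋0 e j = trans (resp≋ e j) (app-0 j)
  open Linear

  Injective : {I J : Set} → Linear I J → Set (c ⊔ ℓ)
  Injective f = ∀ x → app f x ≋ 0f → x ≋ 0f

  Surjective : {I J : Set} → Linear I J → Set (c ⊔ ℓ)
  Surjective f = ∀ y → ∃ λ x → app f x ≋ y

  injective-cancel : {I J : Set} (f : Linear I J) → Injective f → ∀ {x y} → app f x ≋ app f y → x ≋ y
  injective-cancel f inj {x} {y} e i = x∙y⁻¹≈ε⇒x≈y (x i) (y i)
    (inj (x +f (-f y)) (λ j → trans (app-sub f x y j) (x≈y⇒x∙y⁻¹≈ε (e j))) i)

  reindex : {I J : Set} → (J → I) → Linear I J
  reindex ρ = record { app = λ x → x ∘ ρ ; resp≋ = λ e → e ∘ ρ ; add = λ _ _ _ → refl ; scale = λ _ _ _ → refl }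

  idL : {I : Set} → Linear I I
  idL = reindex id

  infixr 9 _∘L_
  _∘L_ : {I J K : Set} → Linear J K → Linear I J → Linear I K
  f ∘L g = record
    { app   = app f ∘ app g
    ; resp≋ = λ e → resp≋ f (resp≋ g e)
    ; add   = λ x y k → trans (resp≋ f (add g x y) k) (add f _ _ k)
    ; scale = λ a x k → trans (resp≋ f (scale g a x) k) (scale f a _ k)
    }

  infixl 6 _+L_
  _+L_ : {I J : Set} → Linear I J → Linear I J → Linear I J
  f +L g = record
    { app   = λ x → app f x +f app g x
    ; resp≋ = λ e j → +-cong (resp≋ f e j) (resp≋ g e j)
    ; add   = λ x y j → trans (+-cong (add f x y j) (add g x y j))
        (solve 4 (λ a b c d → (a :+ b) :+ (c :+ d) := (a :+ c) :+ (b :+ d)) refl _ _ _ _)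
    ; scale = λ a x j → trans (+-cong (scale f a x j) (scale g a x j)) (sym (distribˡ a _ _))
    }

  ray : {J : Set} → Fn J → Linear ⊤ J
  ray v = record
    { app   = λ s → s tt *f v
    ; resp≋ = λ e j → *-congʳ (e tt)
    ; add   = λ x y j → distribʳ _ _ _
    ; scale = λ a x j → *-assoc a _ _
    }

  zeroL : {I J : Set} → Linear I J
  zeroL = record
    { app   = λ _ → 0f
    ; resp≋ = λ _ _ → refl
    ; add   = λ _ _ _ → sym (+-identityˡ 0#)
    ; scale = λ a _ _ → sym (zeroʳ a)
    }

  negL : {I J : Set} → Linear I J → Linear I J
  negL f = record
    { app   = λ x → -f app f x
    ; resp≋ = λ e j → -‿cong (resp≋ f e j)
    ; add   = λ x y j → trans (-‿cong (add f x y j)) (sym (-‿+-comm _ _))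
    ; scale = λ a x j → trans (-‿cong (scale f a x j)) (-‿distribʳ-* a _)
    }

  [_∣_]L : {I J K : Set} → Linear I K → Linear J K → Linear (I ⊎ J) K
  [ f ∣ g ]L = f ∘L reindex inj₁ +L g ∘L reindex inj₂

  ⟨_,_⟩L : {I J K : Set} → Linear K I → Linear K J → Linear K (I ⊎ J)
  ⟨ f , g ⟩L = record
    { app   = λ x → [ app f x , app g x ]′
    ; resp≋ = λ { e (inj₁ i) → resp≋ f e i ; e (inj₂ j) → resp≋ g e j }
    ; add   = λ { x y (inj₁ i) → add f x y i ; x y (inj₂ j) → add g x y j }
    ; scale = λ { a x (inj₁ i) → scale f a x i ; a x (inj₂ j) → scale g a x j }
    }

  cons : ∀ {m} → Carrier → Fn (Fin m) → Fn (Fin (suc m))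
  cons a x zero    = a
  cons a x (suc i) = x i

  cons-η : ∀ {m} (x : Fn (Fin (suc m))) → x ≋ cons (x zero) (x ∘ suc)
  cons-η x zero    = refl
  cons-η x (suc i) = refl

  cons0L : ∀ {m} → Linear (Fin m) (Fin (suc m))
  cons0L = record
    { app   = cons 0#
    ; resp≋ = λ { e zero → refl ; e (suc i) → e i }
    ; add   = λ { x y zero → sym (+-identityˡ 0#) ; x y (suc i) → refl }
    ; scale = λ { a x zero → sym (zeroʳ a) ; a x (suc i) → refl }
    }

  e₀ : ∀ {m} → Fn (Fin (suc m))
  e₀ = cons 1# 0f

  app-cons : ∀ {m} {J : Set} (f : Linear (Fin (suc m)) J) x →
             app f x ≋ x zero *f app f e₀ +f app f (cons 0# (x ∘ suc))
  app-cons f x j = trans (resp≋ f decompose j) (trans (add f _ _ j) (+-congʳ (scale f _ _ j)))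
    where
    decompose : x ≋ x zero *f e₀ +f cons 0# (x ∘ suc)
    decompose zero    = sym (trans (+-identityʳ _) (*-identityʳ _))
    decompose (suc i) = sym (trans (+-congʳ (zeroʳ _)) (+-identityˡ _))

  -- Free modules are projective.
  factor : ∀ k {J K : Set} (ψ : Linear (Fin k) J) (M : Linear K J) →
           (∀ x → ∃ λ y → app M y ≋ app ψ x) →
           ∃ λ (σ : Linear (Fin k) K) → ∀ x → app M (app σ x) ≋ app ψ x
  factor zero    ψ M im = zeroL , λ x j → trans (app-0 M j) (sym (≋0 ψ {x} (λ ()) j))
  factor (suc k) ψ M im with factor k (ψ ∘L cons0L) M (λ x → im (cons 0# x)) | im e₀
  ... | σ , Mσ | y , My = ray y ∘L reindex (λ _ → zero) +L σ ∘L reindex suc ,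
    λ x j → trans (add M _ _ j) (trans (+-cong (trans (scale M _ _ j) (*-congˡ (My j))) (Mσ (x ∘ suc) j))
            (sym (app-cons ψ x j)))

  -- Injective maps and dimension bounds

  endo-injective⇒surjective : ∀ {n} (f : Linear (Fin n) (Fin n)) → Injective f → Surjective f
  endo-injective⇒surjective f inj y
    with injective⇒periodic _≋_ codeFn codeFn-sound (app f) (injective-cancel f inj) y
  ... | d , e = fold y (app f) d , λ i → sym (e i)

  -- If `m` exceeded `k`, padding the values with zeros would give an injective endomorphism of
  -- `F^m`. It would be surjective, yet the padded coordinates of its values vanish, so it misses
  -- the all-ones vector.
  injective⇒≤ : ∀ {m k} (f : Linear (Fin m) (Fin k)) → Injective f → m ≤ k
  injective⇒≤ {m} {k} f inj with m ℕ.≤? k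
  ... | yes m≤k = m≤k
  ... | no  m≰k with ℕₚ.m≤n⇒∃[o]m+o≡n (ℕₚ.≰⇒> m≰k)
  ...   | d , ≡.refl = ⊥-elim (1≉0 (trans (sym (proj₂ hit last)) (pad-last (proj₁ hit))))
    where
    split : Fin (suc k ℕ.+ d) → Fin k ⊎ Fin (suc d)
    split i = splitAt k (≡.subst Fin (≡.sym (ℕₚ.+-suc k d)) i)
    -- The first of the `suc d` padded coordinates, right after the `k` original ones.
    last : Fin (suc k ℕ.+ d)
    last = ≡.subst Fin (ℕₚ.+-suc k d) (k Fin.↑ʳ zero)
    pad : Linear (Fin k) (Fin (suc k ℕ.+ d))
    pad = reindex split ∘L ⟨ idL , zeroL ⟩L
    pad-last : ∀ x → app (pad ∘L f) x last ≈ 0#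
    pad-last x rewrite ≡.subst-sym-subst {P = Fin} (ℕₚ.+-suc k d) {k Fin.↑ʳ zero}
      | Finₚ.splitAt-↑ʳ k (suc d) zero = refl
    pad-inj : Injective pad
    pad-inj x e i = trans (reflexive (≡.cong [ x , 0f ]′ (≡.sym split-i)))
      (e (≡.subst Fin (ℕₚ.+-suc k d) (i Fin.↑ˡ suc d)))
      where
      split-i : split (≡.subst Fin (ℕₚ.+-suc k d) (i Fin.↑ˡ suc d)) ≡ inj₁ i
      split-i rewrite ≡.subst-sym-subst {P = Fin} (ℕₚ.+-suc k d) {i Fin.↑ˡ suc d} = Finₚ.splitAt-↑ˡ k i (suc d)
    hit : ∃ λ x → app (pad ∘L f) x ≋ λ _ → 1#
    hit = endo-injective⇒surjective (pad ∘L f) (λ x e → inj x (pad-inj _ e)) (λ _ → 1#)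

  -- A basis of Q indexed by I, given as its coordinate map.
  record Param {p} {J : Set} (Q : Fn J → Set p) (I : Set) : Set (c ⊔ ℓ ⊔ p) where
    field
      φ    : Linear I J
      inj  : Injective φ
      into : ∀ x → Q (app φ x)
      onto : ∀ {v} → Q v → ∃ λ x → app φ x ≋ v

  -- Stable range one and kernels of surjections

  -- One test vector for `r`: if the functional vanishes there, it vanishes everywhere up to double
  -- negation. Such a vector can be computed without deciding whether `r` is zero.
  Nonvanishing : ∀ {m} → Linear (Fin m) ⊤ → Set (c ⊔ ℓ)
  Nonvanishing r = ∃ λ x → app r x tt ≈ 0# → ¬ ¬ (∀ y → app r y tt ≈ 0#)

  module _ {m} (r : Linear (Fin (suc m)) ⊤) (x′ : Fn (Fin m)) (e : Carrier) where
    private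
      a g : Carrier
      a = app r e₀ tt
      g = app r (cons 0# x′) tt

    -- Meant for `e` the indicator of `a`: the value `a + (1# - e) * g` of `r` is then `a` if `a` is
    -- invertible and `g` if `a` vanishes, which is stable range one in explicit form.
    pivotVector : Fn (Fin (suc m))
    pivotVector = cons 1# ((1# - e) *f x′)

    pivot-value : app r pivotVector tt ≈ a + (1# - e) * g
    pivot-value = trans (app-cons r pivotVector tt)
      (+-cong (*-identityˡ a) (scale (r ∘L cons0L) (1# - e) x′ tt))

    pivot-vanishes-0 : e ≈ 0# → a ≈ 0# → app r pivotVector tt ≈ 0# → g ≈ 0#
    pivot-vanishes-0 e≈0 a≈0 rx≈0 = begin
      g                  ≈⟨ sym (*-identityˡ g) ⟩
      1# * g             ≈⟨ *-congʳ (sym (trans (+-congˡ (trans (-‿cong e≈0) -0#≈0#)) (+-identityʳ 1#))) ⟩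
      (1# - e) * g       ≈⟨ sym (+-identityˡ _) ⟩
      0# + (1# - e) * g  ≈⟨ +-congʳ (sym a≈0) ⟩
      a + (1# - e) * g   ≈⟨ sym pivot-value ⟩
      app r pivotVector tt ≈⟨ rx≈0 ⟩
      0#                 ∎

    pivot-vanishes-1 : e ≈ 1# → app r pivotVector tt ≈ 0# → a ≈ 0#
    pivot-vanishes-1 e≈1 rx≈0 = begin
      a                 ≈⟨ sym (+-identityʳ a) ⟩
      a + 0#            ≈⟨ +-congˡ (sym (zeroˡ g)) ⟩
      a + 0# * g        ≈⟨ +-congˡ (*-congʳ (sym (x≈y⇒x∙y⁻¹≈ε (sym e≈1)))) ⟩
      a + (1# - e) * g  ≈⟨ sym pivot-value ⟩
      app r pivotVector tt ≈⟨ rx≈0 ⟩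
      0#                ∎

  -- The first component of the vector is normalised to 1#, so that it spans a complement
  -- of the vectors with first component 0#.
  pivot : ∀ {m} (r : Linear (Fin (suc m)) ⊤) → Nonvanishing (r ∘L cons0L) →
          ∃ λ x → x zero ≈ 1# × (app r x tt ≈ 0# → ¬ ¬ (∀ y → app r y tt ≈ 0#))
  pivot r (x′ , gen′) = choose (invertibilityIndicator (app r e₀ tt))
    where
    choose : (∃ λ e → (app r e₀ tt ≈ 0# → e ≈ 0#) × (¬ app r e₀ tt ≈ 0# → e ≈ 1#)) →
             ∃ λ x → x zero ≈ 1# × (app r x tt ≈ 0# → ¬ ¬ (∀ y → app r y tt ≈ 0#))
    -- The vector is fixed before the case distinction on `a`, which is allowed because the
    -- conclusion is doubly negated.
    choose (e , e-0 , e-1) = pivotVector r x′ e , refl , λ rx≈0 k → ¬¬-excluded-middle λ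
      { (yes a≈0) → gen′ (pivot-vanishes-0 r x′ e (e-0 a≈0) a≈0 rx≈0) λ r′≈0 →
          k λ y → trans (app-cons r y tt)
            (trans (+-cong (trans (*-congˡ a≈0) (zeroʳ _)) (r′≈0 (y ∘ suc))) (+-identityˡ 0#))
      ; (no a≉0) → a≉0 (pivot-vanishes-1 r x′ e (e-1 a≉0) rx≈0) }

  nonvanishing : ∀ m (r : Linear (Fin m) ⊤) → Nonvanishing r
  nonvanishing zero    r = 0f , λ _ k → k λ y → ≋0 r {y} (λ ()) tt
  nonvanishing (suc m) r = let x , _ , gen = pivot r (nonvanishing m (r ∘L cons0L)) in x , gen

  module _ {m} (r : Linear (Fin (suc m)) ⊤) (x : Fn (Fin (suc m))) (x₀≈1 : x zero ≈ 1#)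
           (h : Carrier) (gh≈1 : app r x tt * h ≈ 1#) where
    private
      g : Carrier
      g = app r x tt
      x₁ : Fn (Fin (suc m))
      x₁ = h *f x
      rx₁≈1 : app r x₁ tt ≈ 1#
      rx₁≈1 = trans (scale r h x tt) (trans (*-comm h g) gh≈1)
      r₀ : Linear (Fin m) ⊤
      r₀ = r ∘L cons0L
      -- Projection along `x₁` of the vectors with first component `0#` onto the kernel of `r`. Both
      -- spaces are complements of the line through `x₁`, since `x₁ zero ≈ h` is invertible and `r`
      -- takes the value `1#` at `x₁`; hence it is bijective.
      κ : Linear (Fin m) (Fin (suc m))
      κ = cons0L +L negL (ray x₁ ∘L r₀)
      κ-into : ∀ y → app r (app κ y) tt ≈ 0#
      κ-into y = trans (app-sub r (cons 0# y) (app r₀ y tt *f x₁) tt)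
        (x≈y⇒x∙y⁻¹≈ε (sym (trans (scale r _ x₁ tt) (trans (*-congˡ rx₁≈1) (*-identityʳ _)))))
      κ-inj : Injective κ
      κ-inj y κy≈0 i = begin
        y i                              ≈⟨ sym (+-identityʳ _) ⟩
        y i + 0#                         ≈⟨ +-congˡ (sym -0#≈0#) ⟩
        y i + - 0#                       ≈⟨ +-congˡ (-‿cong (sym (trans (*-congʳ ry≈0) (zeroˡ _)))) ⟩
        y i + - (app r₀ y tt * x₁ (suc i)) ≈⟨ κy≈0 (suc i) ⟩
        0#                               ∎
        where
        ry≈0 : app r₀ y tt ≈ 0#
        ry≈0 = begin
          app r₀ y tt                        ≈⟨ sym (*-identityʳ _) ⟩
          app r₀ y tt * 1#                   ≈⟨ *-congˡ (sym gh≈1) ⟩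
          app r₀ y tt * (g * h)              ≈⟨ *-congˡ (*-congˡ (sym (trans (*-congˡ x₀≈1) (*-identityʳ h)))) ⟩
          app r₀ y tt * (g * (h * x zero))   ≈⟨ solve 3 (λ s g t → s :* (g :* t) := g :* (s :* t)) refl _ _ _ ⟩
          g * (app r₀ y tt * x₁ zero)        ≈⟨ *-congˡ (sym (x∙y⁻¹≈ε⇒x≈y _ _ (κy≈0 zero))) ⟩
          g * 0#                             ≈⟨ zeroʳ g ⟩
          0#                                 ∎
      κ-onto : ∀ {z} → app r z tt ≈ 0# → ∃ λ y → app κ y ≋ z
      κ-onto {z} rz≈0 = y , hit
        where
        s : Carrier
        -- As `x₁ zero ≈ h` has inverse `g`, subtracting this multiple of `x₁` clears the first
        -- component of `z`; `κ` adds it back because `r` takes the value `- s` on the result.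
        s = z zero * g
        w : Fn (Fin (suc m))
        w = z +f (-f (s *f x₁))
        y : Fn (Fin m)
        y = w ∘ suc
        w₀ : w zero ≈ 0#
        w₀ = x≈y⇒x∙y⁻¹≈ε (sym (begin
          z zero * g * (h * x zero)  ≈⟨ *-congˡ (trans (*-congˡ x₀≈1) (*-identityʳ h)) ⟩
          z zero * g * h             ≈⟨ *-assoc _ g h ⟩
          z zero * (g * h)           ≈⟨ *-congˡ gh≈1 ⟩
          z zero * 1#                ≈⟨ *-identityʳ _ ⟩
          z zero                     ∎))
        cons-y : cons 0# y ≋ w
        cons-y zero    = sym w₀
        cons-y (suc i) = refl
        ry : app r₀ y tt ≈ - s
        ry = begin
          app r (cons 0# y) tt              ≈⟨ resp≋ r cons-y tt ⟩
          app r w tt                        ≈⟨ app-sub r z (s *f x₁) tt ⟩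
          app r z tt + - app r (s *f x₁) tt
          ≈⟨ +-cong rz≈0 (-‿cong (trans (scale r s x₁ tt) (trans (*-congˡ rx₁≈1) (*-identityʳ s)))) ⟩
          0# + - s                          ≈⟨ +-identityˡ _ ⟩
          - s                               ∎
        hit : app κ y ≋ z
        hit i = begin
          cons 0# y i + - (app r₀ y tt * x₁ i)    ≈⟨ +-cong (cons-y i) (-‿cong (*-congʳ ry)) ⟩
          (z i + - (s * x₁ i)) + - (- s * x₁ i)   ≈⟨ +-congˡ (trans (-‿cong (sym (-‿distribˡ-* s _))) (-‿involutive _)) ⟩
          (z i + - (s * x₁ i)) + s * x₁ i         ≈⟨ +-assoc _ _ _ ⟩
          z i + (- (s * x₁ i) + s * x₁ i)         ≈⟨ +-congˡ (-‿inverseˡ _) ⟩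
          z i + 0#                                ≈⟨ +-identityʳ _ ⟩
          z i                                     ∎

    kernel-of-pivot : (∃ λ x → app r x tt ≈ 1#) × Param (λ z → app r z tt ≈ 0#) (Fin m)
    kernel-of-pivot = (x₁ , rx₁≈1) , record { φ = κ ; inj = κ-inj ; into = κ-into ; onto = κ-onto }

  -- The hypothesis is negative, yet it yields a pivot: `inverse` asks only for a refutation of
  -- `≈ 0#`, and `gen` turns the hypothesis into one.
  kernel-functional : ∀ {m} (r : Linear (Fin (suc m)) ⊤) → ¬ (∀ y → app r y tt ≈ 0#) →
    (∃ λ x → app r x tt ≈ 1#) × Param (λ z → app r z tt ≈ 0#) (Fin m)
  kernel-functional {m} r r≉0 =
    let x , x₀≈1 , gen = pivot r (nonvanishing m (r ∘L cons0L))
        h , gh≈1       = inverse (app r x tt) (λ e → gen e r≉0)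
    in kernel-of-pivot r x x₀≈1 h gh≈1

  module _ {n m} (M : Linear (Fin (suc m)) (Fin (suc n)))
           (x₁ : Fn (Fin (suc m))) (rx₁≈1 : app M x₁ zero ≈ 1#)
           (K : Param (λ z → app M z zero ≈ 0#) (Fin m)) where
    private
      module K = Param K

    -- No column is deleted: the columns are replaced by a basis of the kernel of the first row, and
    -- this is what elimination by that row leaves of the other rows.
    minor : Linear (Fin m) (Fin n)
    minor = reindex suc ∘L M ∘L K.φ

    minor-surjective : Surjective M → Surjective minor
    minor-surjective surj v =
      let z , Mz   = surj (cons 0# v)
          y , κy≋z = K.onto {z} (Mz zero)
      in y , λ i → trans (resp≋ M κy≋z (suc i)) (Mz (suc i))

    -- `x₁` sets the first component. The correction `app K.φ y` lies in the kernel of the first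
    -- row, so it repairs the other components without disturbing that one.
    surjective-from-minor : Surjective minor → Surjective M
    surjective-from-minor minor-surj v = v zero *f x₁ +f app K.φ y , hit
      where
      solution : ∃ λ y → app minor y ≋ (λ i → v (suc i) + - (v zero * app M x₁ (suc i)))
      solution = minor-surj _
      y : Fn (Fin m)
      y = proj₁ solution
      Mv : app M (v zero *f x₁ +f app K.φ y) ≋ v zero *f app M x₁ +f app M (app K.φ y)
      Mv i = trans (add M _ _ i) (+-congʳ (scale M _ x₁ i))
      hit : app M (v zero *f x₁ +f app K.φ y) ≋ v
      hit zero    = trans (Mv zero)
        (trans (+-cong (trans (*-congˡ rx₁≈1) (*-identityʳ _)) (K.into y)) (+-identityʳ _))
      hit (suc i) = trans (Mv (suc i))
        (trans (+-congˡ (proj₂ solution i)) (trans (sym (+-assoc _ _ _)) (xyx⁻¹≈y _ _)))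

    kernel-from-minor : ∀ {I} → Param (λ y → app minor y ≋ 0f) I → Param (λ x → app M x ≋ 0f) I
    kernel-from-minor L = record
      { φ = K.φ ∘L L.φ ; inj = λ x e → L.inj x (K.inj _ e) ; into = into′ ; onto = onto′ }
      where
      module L = Param L
      into′ : ∀ x → app M (app K.φ (app L.φ x)) ≋ 0f
      into′ x zero    = K.into (app L.φ x)
      into′ x (suc i) = L.into x i
      onto′ : ∀ {v} → app M v ≋ 0f → ∃ λ x → app (K.φ ∘L L.φ) x ≋ v
      onto′ {v} Mv≋0 =
        let y , κy≋v = K.onto {v} (Mv≋0 zero)
            x , λx≋y = L.onto {y} (λ i → trans (resp≋ M κy≋v (suc i)) (Mv≋0 (suc i)))
        in x , λ i → trans (resp≋ K.φ λx≋y i) (κy≋v i)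

  -- A pivot requires only a refutation, so doubly negated surjectivity suffices here; `kernel-free`
  -- thereby recovers actual surjectivity.
  surjective-row≉0 : ∀ {n} {I : Set} (M : Linear I (Fin (suc n))) → ¬ ¬ Surjective M →
                     ¬ (∀ x → app M x zero ≈ 0#)
  surjective-row≉0 M ¬¬surj r≈0 = ¬¬surj λ surj →
    let x , Mx≋1 = surj (λ _ → 1#) in 1≉0 (trans (sym (Mx≋1 zero)) (r≈0 x))

  -- Gaussian elimination with stable-range-one pivots in place of zero tests.
  kernel-free : ∀ n {m} (M : Linear (Fin m) (Fin n)) → ¬ ¬ Surjective M →
    ∃ λ k → m ≡ n ℕ.+ k × Surjective M × Param (λ x → app M x ≋ 0f) (Fin k)
  kernel-free zero {m} M _ = m , ≡.refl , (λ _ → 0f , λ ()) , record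
    { φ = idL ; inj = λ _ e → e ; into = λ _ () ; onto = λ {v} _ → v , λ _ → refl }
  kernel-free (suc n) {zero} M ¬¬surj =
    ⊥-elim (surjective-row≉0 M ¬¬surj (λ x → ≋0 M {x} (λ ()) zero))
  kernel-free (suc n) {suc m} M ¬¬surj =
    let (x₁ , rx₁≈1) , K        = kernel-functional (reindex (λ _ → zero) ∘L M) (surjective-row≉0 M ¬¬surj)
        k , m≡n+k , surj , L = kernel-free n (minor M x₁ rx₁≈1 K) (¬¬-map (minor-surjective M x₁ rx₁≈1 K) ¬¬surj)
    in k , ≡.cong suc m≡n+k , surjective-from-minor M x₁ rx₁≈1 K surj , kernel-from-minor M x₁ rx₁≈1 K L

  -- Subspaces, sums and intersections

  infix 4 _∋_
  _∋_ : ∀ {n} → Subspace F n → Fn (Fin n) → Set (c ⊔ ℓ)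
  S ∋ x = mem S (tabulate x)

  lookup-tabulate : ∀ {n} (x : Fn (Fin n)) → lookup (tabulate x) ≋ x
  lookup-tabulate x i = reflexive (Vecₚ.lookup∘tabulate x i)

  module _ {n} (S : Subspace F n) where

    mem⇒∋ : ∀ {v} → mem S v → S ∋ lookup v
    mem⇒∋ {v} = ≡.subst (mem S) (≡.sym (Vecₚ.tabulate∘lookup v))

    ∋⇒mem : ∀ {x v} → x ≋ lookup v → S ∋ x → mem S v
    ∋⇒mem {x} e = resp S (λ i → trans (lookup-tabulate x i) (e i))

    ∋-resp : ∀ {x y} → x ≋ y → S ∋ x → S ∋ y
    ∋-resp {y = y} e = ∋⇒mem (λ i → trans (e i) (sym (lookup-tabulate y i)))

    ∋-0 : S ∋ 0f
    ∋-0 = resp S (λ i → reflexive (≡.trans (Vecₚ.lookup-replicate i 0#) (≡.sym (Vecₚ.lookup∘tabulate 0f i)))) (0∈ S)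

    ∋-+ : ∀ {x y} → S ∋ x → S ∋ y → S ∋ x +f y
    ∋-+ {x} {y} x∈ y∈ = resp S (λ i → trans (reflexive (Vecₚ.lookup-zipWith _+_ i (tabulate x) (tabulate y)))
      (trans (+-cong (lookup-tabulate x i) (lookup-tabulate y i)) (sym (lookup-tabulate (x +f y) i)))) (+∈ S x∈ y∈)

    ∋-* : ∀ a {x} → S ∋ x → S ∋ a *f x
    ∋-* a {x} x∈ = resp S (λ i → trans (reflexive (Vecₚ.lookup-map i (a *_) (tabulate x)))
      (trans (*-congˡ (lookup-tabulate x i)) (sym (lookup-tabulate (a *f x) i)))) (·∈ S a x∈)

    ∋-neg : ∀ {x} → S ∋ x → S ∋ -f x
    ∋-neg {x} x∈ = ∋-resp (λ i → -1*x≈-x (x i)) (∋-* (- 1#) x∈)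

  capSub : ∀ {n} → Subspace F n → Subspace F n → Subspace F n
  capSub U W = record
    { mem  = capS F U W
    ; resp = λ e (u , w) → resp U e u , resp W e w
    ; 0∈   = 0∈ U , 0∈ W
    ; +∈   = λ (u , w) (u′ , w′) → +∈ U u u′ , +∈ W w w′
    ; ·∈   = λ a (u , w) → ·∈ U a u , ·∈ W a w
    }

  sumSub : ∀ {n} → Subspace F n → Subspace F n → Subspace F n
  sumSub U W = record
    { mem  = sumS F U W
    ; resp = λ e (u , w , u∈ , w∈ , v≈) → u , w , u∈ , w∈ , λ i → trans (sym (e i)) (v≈ i)
    ; 0∈   = _ , _ , 0∈ U , 0∈ W , λ i → sym (trans (reflexive (Vecₚ.lookup-zipWith _+_ i (0v F) (0v F)))
               (trans (+-congˡ (reflexive (Vecₚ.lookup-replicate i 0#))) (+-identityʳ _)))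
    ; +∈   = λ { {v} {v′} (u , w , u∈ , w∈ , v≈) (u′ , w′ , u′∈ , w′∈ , v′≈) →
               _ , _ , +∈ U u∈ u′∈ , +∈ W w∈ w′∈ , λ i → begin
                 lookup (Vec.zipWith _+_ v v′) i
                   ≡⟨ Vecₚ.lookup-zipWith _+_ i v v′ ⟩
                 lookup v i + lookup v′ i
                   ≈⟨ +-cong (v≈ i) (v′≈ i) ⟩
                 lookup (Vec.zipWith _+_ u w) i + lookup (Vec.zipWith _+_ u′ w′) i
                   ≡⟨ ≡.cong₂ _+_ (Vecₚ.lookup-zipWith _+_ i u w) (Vecₚ.lookup-zipWith _+_ i u′ w′) ⟩
                 (lookup u i + lookup w i) + (lookup u′ i + lookup w′ i)
                   ≈⟨ solve 4 (λ a b c d → (a :+ b) :+ (c :+ d) := (a :+ c) :+ (b :+ d)) refl _ _ _ _ ⟩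
                 (lookup u i + lookup u′ i) + (lookup w i + lookup w′ i)
                   ≡⟨ ≡.cong₂ _+_ (Vecₚ.lookup-zipWith _+_ i u u′) (Vecₚ.lookup-zipWith _+_ i w w′) ⟨
                 lookup (Vec.zipWith _+_ u u′) i + lookup (Vec.zipWith _+_ w w′) i
                   ≡⟨ Vecₚ.lookup-zipWith _+_ i (Vec.zipWith _+_ u u′) (Vec.zipWith _+_ w w′) ⟨
                 lookup (Vec.zipWith _+_ (Vec.zipWith _+_ u u′) (Vec.zipWith _+_ w w′)) i ∎ }
    ; ·∈   = λ { a {v} (u , w , u∈ , w∈ , v≈) →
               _ , _ , ·∈ U a u∈ , ·∈ W a w∈ , λ i → begin
                 lookup (Vec.map (a *_) v) i
                   ≡⟨ Vecₚ.lookup-map i (a *_) v ⟩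
                 a * lookup v i
                   ≈⟨ *-congˡ (trans (v≈ i) (reflexive (Vecₚ.lookup-zipWith _+_ i u w))) ⟩
                 a * (lookup u i + lookup w i)
                   ≈⟨ distribˡ a _ _ ⟩
                 a * lookup u i + a * lookup w i
                   ≡⟨ ≡.cong₂ _+_ (Vecₚ.lookup-map i (a *_) u) (Vecₚ.lookup-map i (a *_) w) ⟨
                 lookup (Vec.map (a *_) u) i + lookup (Vec.map (a *_) w) i
                   ≡⟨ Vecₚ.lookup-zipWith _+_ i (Vec.map (a *_) u) (Vec.map (a *_) w) ⟨
                 lookup (Vec.zipWith _+_ (Vec.map (a *_) u) (Vec.map (a *_) w)) i ∎ }
    }

  ∋-sum⁺ : ∀ {n} (U W : Subspace F n) {x y z} → U ∋ y → W ∋ z → x ≋ y +f z → sumSub U W ∋ x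
  ∋-sum⁺ U W {x} {y} {z} y∈ z∈ e = _ , _ , y∈ , z∈ , λ i → begin
    lookup (tabulate x) i                                ≈⟨ lookup-tabulate x i ⟩
    x i                                                  ≈⟨ e i ⟩
    y i + z i                                            ≈⟨ sym (+-cong (lookup-tabulate y i) (lookup-tabulate z i)) ⟩
    lookup (tabulate y) i + lookup (tabulate z) i        ≡⟨ Vecₚ.lookup-zipWith _+_ i (tabulate y) (tabulate z) ⟨
    lookup (Vec.zipWith _+_ (tabulate y) (tabulate z)) i ∎

  ∋-sum⁻ : ∀ {n} (U W : Subspace F n) {x} → sumSub U W ∋ x → ∃₂ λ y z → U ∋ y × W ∋ z × x ≋ y +f z
  ∋-sum⁻ U W {x} (u , w , u∈ , w∈ , e) = lookup u , lookup w , mem⇒∋ U u∈ , mem⇒∋ W w∈ , λ i →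
    trans (sym (lookup-tabulate x i)) (trans (e i) (reflexive (Vecₚ.lookup-zipWith _+_ i u w)))

  -- Bases as lists and as coordinate maps

  comb : ∀ {n} (vs : List (V F n)) → Linear (Fin (length vs)) (Fin n)
  comb []       = zeroL
  comb (v ∷ vs) = ray (lookup v) ∘L reindex (λ _ → zero) +L comb vs ∘L reindex suc

  lookup-lincomb : ∀ {n} (vs : List (V F n)) as → lookup (lincomb F vs as) ≋ app (comb vs) (lookup as)
  lookup-lincomb []       []       i = reflexive (Vecₚ.lookup-replicate i 0#)
  lookup-lincomb (v ∷ vs) (a ∷ as) i = trans
    (reflexive (Vecₚ.lookup-zipWith _+_ i (Vec.map (a *_) v) (lincomb F vs as)))
    (+-cong (reflexive (Vecₚ.lookup-map i (a *_) v)) (lookup-lincomb vs as i))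

  comb-∋ : ∀ {n} (S : Subspace F n) {vs} → All (mem S) vs → ∀ x → S ∋ app (comb vs) x
  comb-∋ S []         x = ∋-0 S
  comb-∋ S (v∈ ∷ vs∈) x = ∋-+ S (∋-* S (x zero) (mem⇒∋ S v∈)) (comb-∋ S vs∈ (x ∘ suc))

  HasDim⇒Param : ∀ {n} (S : Subspace F n) {k} → HasDim F (mem S) k → Param (S ∋_) (Fin k)
  HasDim⇒Param S (vs , ≡.refl , vs∈ , indep , span) = record
    { φ    = comb vs
    ; inj  = λ x e j → trans (sym (lookup-tabulate x j))
               (indep (tabulate x) (λ i → trans (lookup-lincomb vs (tabulate x) i)
                  (trans (resp≋ (comb vs) (lookup-tabulate x) i)
                     (trans (e i) (reflexive (≡.sym (Vecₚ.lookup-replicate i 0#)))))) j)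
    ; into = comb-∋ S vs∈
    ; onto = λ {v} v∈ → let as , e = span (tabulate v) v∈ in
               lookup as , λ i → trans (sym (lookup-lincomb vs as i)) (trans (e i) (lookup-tabulate v i))
    }

  columns : ∀ k {n} → Linear (Fin k) (Fin n) → List (V F n)
  columns zero    φ = []
  columns (suc k) φ = tabulate (app φ e₀) ∷ columns k (φ ∘L cons0L)

  length-columns : ∀ k {n} (φ : Linear (Fin k) (Fin n)) → length (columns k φ) ≡ k
  length-columns zero    φ = ≡.refl
  length-columns (suc k) φ = ≡.cong suc (length-columns k (φ ∘L cons0L))

  -- The length of `columns k φ` equals `k` only propositionally, so coefficient vectors are
  -- translated by recursion instead of transport.
  coords : ∀ k {n} (φ : Linear (Fin k) (Fin n)) → Vec Carrier (length (columns k φ)) → Fn (Fin k)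
  coords zero    φ []       = 0f
  coords (suc k) φ (a ∷ as) = cons a (coords k (φ ∘L cons0L) as)

  coords-surjective : ∀ k {n} (φ : Linear (Fin k) (Fin n)) x → ∃ λ as → coords k φ as ≋ x
  coords-surjective zero    φ x = [] , λ ()
  coords-surjective (suc k) φ x with coords-surjective k (φ ∘L cons0L) (x ∘ suc)
  ... | as , e = x zero ∷ as , λ { zero → refl ; (suc i) → e i }

  coords-injective : ∀ k {n} (φ : Linear (Fin k) (Fin n)) as → coords k φ as ≋ 0f → ∀ j → lookup as j ≈ 0#
  coords-injective (suc k) φ (a ∷ as) e zero    = e zero
  coords-injective (suc k) φ (a ∷ as) e (suc j) = coords-injective k (φ ∘L cons0L) as (e ∘ suc) j

  lincomb-columns : ∀ k {n} (φ : Linear (Fin k) (Fin n)) as →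
                    lookup (lincomb F (columns k φ) as) ≋ app φ (coords k φ as)
  lincomb-columns zero    φ []       i = trans (reflexive (Vecₚ.lookup-replicate i 0#)) (sym (≋0 φ {0f} (λ ()) i))
  lincomb-columns (suc k) φ (a ∷ as) i = begin
    lookup (Vec.zipWith _+_ (Vec.map (a *_) (tabulate (app φ e₀))) rest) i
      ≡⟨ Vecₚ.lookup-zipWith _+_ i (Vec.map (a *_) (tabulate (app φ e₀))) rest ⟩
    lookup (Vec.map (a *_) (tabulate (app φ e₀))) i + lookup rest i
      ≈⟨ +-cong (trans (reflexive (Vecₚ.lookup-map i (a *_) (tabulate (app φ e₀))))
                   (*-congˡ (lookup-tabulate (app φ e₀) i)))
                (lincomb-columns k (φ ∘L cons0L) as i) ⟩
    a * app φ e₀ i + app φ (cons 0# (coords k (φ ∘L cons0L) as)) i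
      ≈⟨ sym (app-cons φ (coords (suc k) φ (a ∷ as)) i) ⟩
    app φ (coords (suc k) φ (a ∷ as)) i ∎
    where
    rest : V F _
    rest = lincomb F (columns k (φ ∘L cons0L)) as

  columns-∋ : ∀ k {n} (S : Subspace F n) (φ : Linear (Fin k) (Fin n)) →
              (∀ x → S ∋ app φ x) → All (mem S) (columns k φ)
  columns-∋ zero    S φ into = []
  columns-∋ (suc k) S φ into = into e₀ ∷ columns-∋ k S (φ ∘L cons0L) (into ∘ cons 0#)

  Param⇒HasDim : ∀ {n} (S : Subspace F n) {k} → Param (S ∋_) (Fin k) → HasDim F (mem S) k
  Param⇒HasDim S {k} P = columns k φ , length-columns k φ , columns-∋ k S φ into , indep , span
    where
    open Param P
    indep : LinIndep F (columns k φ)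
    indep as e = coords-injective k φ as (inj _ λ i → trans (sym (lincomb-columns k φ as i))
      (trans (e i) (reflexive (Vecₚ.lookup-replicate i 0#))))
    span : ∀ v → mem S v → ∃ λ as → _≈v_ F (lincomb F (columns k φ) as) v
    span v v∈ =
      let x , φx≋v = onto {lookup v} (mem⇒∋ S v∈)
          as , e   = coords-surjective k φ x
      in as , λ i → trans (lincomb-columns k φ as i) (trans (resp≋ φ e i) (φx≋v i))

  -- Dimension counts

  -- `factor` writes the inclusion in coordinates; the resulting map is injective because the
  -- coordinate map of `P` is.
  dim-mono : ∀ {p q k k′} {J : Set} {P : Fn J → Set p} {Q : Fn J → Set q} →
             Param P (Fin k) → Param Q (Fin k′) → (∀ {x} → P x → Q x) → k ≤ k′
  dim-mono A B P⊆Q =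
    let σ , e = factor _ A.φ B.φ (λ x → B.onto (P⊆Q (A.into x)))
    in injective⇒≤ σ (λ x σx≋0 → A.inj x λ j → trans (sym (e x j)) (≋0 B.φ σx≋0 j))
    where
    module A = Param A
    module B = Param B

  dim-≤-ambient : ∀ {n p k} {P : Fn (Fin n) → Set p} → Param P (Fin k) → k ≤ n
  dim-≤-ambient A = injective⇒≤ (Param.φ A) (Param.inj A)

  module _ {n t t′} (U W : Subspace F n) (A : Param (U ∋_) (Fin t)) (B : Param (W ∋_) (Fin t′)) where
    private
      module A = Param A
      module B = Param B

    sumL : Linear (Fin t ⊎ Fin t′) (Fin n)
    sumL = [ A.φ ∣ B.φ ]L

    sumL-∋ : ∀ x → sumSub U W ∋ app sumL x
    sumL-∋ x = ∋-sum⁺ U W (A.into _) (B.into _) (λ _ → refl)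

    sumL-onto : ∀ {v} → sumSub U W ∋ v → ∃ λ x → app sumL x ≋ v
    sumL-onto v∈ =
      let _ , _ , y∈ , z∈ , e = ∋-sum⁻ U W v∈
          a , a≋              = A.onto y∈
          b , b≋              = B.onto z∈
      in [ a , b ]′ , λ i → trans (+-cong (a≋ i) (b≋ i)) (sym (e i))

    -- A relation `u + w ≋ 0f` gives `u ≋ -f w`, so `u` lies in `W` too: the kernel of
    -- `U ⊕ W → U + W` is a copy of the intersection.
    kernel-∋-cap : ∀ x → app sumL x ≋ 0f → capSub U W ∋ app A.φ (x ∘ inj₁)
    kernel-∋-cap x e = A.into _ , ∋-resp W (λ i → sym (+-inverseˡ-unique _ _ (e i))) (∋-neg W (B.into (x ∘ inj₂)))

    -- From a vector of U ⊕ W subtract a lift of its image in U + W; what remains lies in U ∩ W.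
    dim-sum-cap : ∀ {s i} → Param (sumSub U W ∋_) (Fin s) → Param (capSub U W ∋_) (Fin i) →
                  t ℕ.+ t′ ≤ s ℕ.+ i
    dim-sum-cap {s} {i} S C = injective⇒≤ (reindex (splitAt s) ∘L ⟨ ξ , ζ ⟩L) injective
      where
      module S = Param S
      module C = Param C
      split : Linear (Fin (t ℕ.+ t′)) (Fin t ⊎ Fin t′)
      split = reindex (join t t′)
      Σσ : ∃ λ (σ : Linear (Fin s) (Fin t ⊎ Fin t′)) → ∀ x → app sumL (app σ x) ≋ app S.φ x
      Σσ = factor s S.φ sumL (λ x → sumL-onto (S.into x))
      Σξ : ∃ λ (ξ : Linear (Fin (t ℕ.+ t′)) (Fin s)) → ∀ x → app S.φ (app ξ x) ≋ app (sumL ∘L split) x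
      Σξ = factor _ (sumL ∘L split) S.φ (λ x → S.onto (sumL-∋ (app split x)))
      σ : Linear (Fin s) (Fin t ⊎ Fin t′)
      σ = proj₁ Σσ
      ξ : Linear (Fin (t ℕ.+ t′)) (Fin s)
      ξ = proj₁ Σξ
      δ : Linear (Fin (t ℕ.+ t′)) (Fin t ⊎ Fin t′)
      δ = split +L negL (σ ∘L ξ)
      δ-kernel : ∀ x → app sumL (app δ x) ≋ 0f
      δ-kernel x j = trans (app-sub sumL (app split x) (app σ (app ξ x)) j)
        (x≈y⇒x∙y⁻¹≈ε (sym (trans (proj₂ Σσ (app ξ x) j) (proj₂ Σξ x j))))
      Σζ : ∃ λ (ζ : Linear (Fin (t ℕ.+ t′)) (Fin i)) → ∀ x → app C.φ (app ζ x) ≋ app (A.φ ∘L reindex inj₁ ∘L δ) x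
      Σζ = factor _ (A.φ ∘L reindex inj₁ ∘L δ) C.φ (λ x → C.onto (kernel-∋-cap (app δ x) (δ-kernel x)))
      ζ : Linear (Fin (t ℕ.+ t′)) (Fin i)
      ζ = proj₁ Σζ
      injective : Injective (reindex (splitAt s) ∘L ⟨ ξ , ζ ⟩L)
      injective x e = x≋0
        where
        ξx≋0 : app ξ x ≋ 0f
        ξx≋0 j = trans (reflexive (≡.cong [ app ξ x , app ζ x ]′ (≡.sym (Finₚ.splitAt-↑ˡ s j i)))) (e (j Fin.↑ˡ i))
        ζx≋0 : app ζ x ≋ 0f
        ζx≋0 j = trans (reflexive (≡.cong [ app ξ x , app ζ x ]′ (≡.sym (Finₚ.splitAt-↑ʳ s i j)))) (e (s Fin.↑ʳ j))
        -- Since `ξ x` is zero, nothing has been subtracted and the remainder is the original pair.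
        δx≋x : app δ x ≋ app split x
        δx≋x j = trans (+-congˡ (trans (-‿cong (≋0 σ ξx≋0 j)) -0#≈0#)) (+-identityʳ _)
        left : app split x ∘ inj₁ ≋ 0f
        left = A.inj _ λ j → trans (sym (resp≋ A.φ (δx≋x ∘ inj₁) j))
          (trans (sym (proj₂ Σζ x j)) (≋0 C.φ ζx≋0 j))
        right : app split x ∘ inj₂ ≋ 0f
        right = B.inj _ λ j → begin
          app B.φ (app split x ∘ inj₂) j      ≈⟨ sym (+-identityˡ _) ⟩
          0# + app B.φ (app split x ∘ inj₂) j ≈⟨ +-congʳ (sym (≋0 A.φ left j)) ⟩
          app sumL (app split x) j            ≈⟨ sym (proj₂ Σξ x j) ⟩
          app S.φ (app ξ x) j                 ≈⟨ ≋0 S.φ ξx≋0 j ⟩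
          0#                                  ∎
        split≋0 : app split x ≋ 0f
        split≋0 (inj₁ j) = left j
        split≋0 (inj₂ j) = right j
        x≋0 : x ≋ 0f
        x≋0 j = trans (reflexive (≡.cong x (≡.sym (Finₚ.join-splitAt t t′ j)))) (split≋0 (splitAt t j))

  -- Over a field without decidable equality a basis exists only up to double negation.
  module _ {n} (S : Subspace F n) (zero? : ∀ x → Dec (x ≈ 0#)) where

    extend-basis : ∀ fuel k → k ℕ.+ fuel ≡ suc n → (φ : Linear (Fin k) (Fin n)) → Injective φ →
                   (∀ x → S ∋ app φ x) → ¬ ¬ (∃ λ k → Param (S ∋_) (Fin k))
    extend-basis zero k k≡1+n φ inj into _ =
      -- Out of fuel, `k` is `suc n`: more independent vectors than `n` coordinates allow.
      ℕₚ.<-irrefl ≡.refl (ℕₚ.≤-trans (ℕₚ.≤-reflexive (≡.trans (≡.sym k≡1+n) (ℕₚ.+-identityʳ k))) (injective⇒≤ φ inj))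
    extend-basis (suc fuel) k k+f≡n φ inj into done =
      ¬¬-excluded-middle {A = ∃ λ v → S ∋ v × ∀ x → ¬ app φ x ≋ v} λ
        { (yes (v , v∈ , v∉)) → extend-basis fuel (suc k) (≡.trans (≡.sym (ℕₚ.+-suc k fuel)) k+f≡n)
            (φ′ v) (φ′-inj v v∉) (λ x → ∋-+ S (∋-* S (x zero) v∈) (into (x ∘ suc))) done
        -- Every vector is equivalent to a decoded one, so finitely many statements have to be
        -- collected under the double negation.
        ; (no none) → ¬¬-all {P = λ k → S ∋ decodeFn k → ∃ λ x → app φ x ≋ decodeFn {n} k}
            (λ k missing → missing λ v∈ → ⊥-elim (none (decodeFn k , v∈ , λ x e → missing λ _ → x , e)))
            λ hit → done (k , record { φ = φ ; inj = inj ; into = into ; onto = λ {v} v∈ →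
              let x , e = hit (codeFn v) (∋-resp S (decode-code v) v∈)
              in x , λ i → trans (e i) (sym (decode-code v i)) }) }
      where
      φ′ : Fn (Fin n) → Linear (Fin (suc k)) (Fin n)
      φ′ v = ray v ∘L reindex (λ _ → zero) +L φ ∘L reindex suc
      φ′-inj : ∀ v → (∀ x → ¬ app φ x ≋ v) → Injective (φ′ v)
      φ′-inj v v∉ x e with zero? (x zero)
      ... | yes x₀≈0 = λ { zero → x₀≈0 ; (suc i) → inj (x ∘ suc) (λ j →
              trans (sym (trans (+-congʳ (trans (*-congʳ x₀≈0) (zeroˡ _))) (+-identityˡ _))) (e j)) i }
      ... | no x₀≉0 = ⊥-elim (v∉ ((- h) *f (x ∘ suc)) λ j → begin
              app φ ((- h) *f (x ∘ suc)) j   ≈⟨ scale φ (- h) (x ∘ suc) j ⟩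
              - h * app φ (x ∘ suc) j        ≈⟨ *-congˡ (+-inverseʳ-unique _ _ (e j)) ⟩
              - h * - (x zero * v j)         ≈⟨ sym (-‿distribˡ-* h _) ⟩
              - (h * - (x zero * v j))       ≈⟨ -‿cong (sym (-‿distribʳ-* h _)) ⟩
              - - (h * (x zero * v j))       ≈⟨ -‿involutive _ ⟩
              h * (x zero * v j)             ≈⟨ solve 3 (λ h a b → h :* (a :* b) := a :* h :* b) refl _ _ _ ⟩
              x zero * h * v j               ≈⟨ *-congʳ (proj₂ (inverse (x zero) x₀≉0)) ⟩
              1# * v j                       ≈⟨ *-identityˡ _ ⟩
              v j                            ∎)
        where
        h : Carrier
        h = proj₁ (inverse (x zero) x₀≉0)

  ¬¬-HasDim : ∀ {n} (S : Subspace F n) → ¬ ¬ (∃ λ k → HasDim F (mem S) k)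
  ¬¬-HasDim {n} S none = ¬¬-decidable λ zero? →
    extend-basis S zero? (suc n) 0 ≡.refl zeroL (λ _ _ ()) (λ _ → ∋-0 S)
      λ (k , P) → none (k , Param⇒HasDim S P)

  HasDim-unique : ∀ {n} (S : Subspace F n) {k k′} → HasDim F (mem S) k → HasDim F (mem S) k′ → k ≡ k′
  HasDim-unique S A B = ℕₚ.≤-antisym (dim-mono A′ B′ id) (dim-mono B′ A′ id)
    where
    A′ = HasDim⇒Param S A
    B′ = HasDim⇒Param S B

  DistS-unique : ∀ {n} (U W : Subspace F n) {d d′} → DistS F U W d → DistS F U W d′ → d ≡ d′
  DistS-unique U W (_ , _ , S , C , ≡.refl) (_ , _ , S′ , C′ , ≡.refl) =
    ≡.cong₂ _∸_ (HasDim-unique (sumSub U W) S S′) (HasDim-unique (capSub U W) C C′)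

  -- A distance comes with bases of the sum and of the intersection, so it exists only up to double
  -- negation. This suffices when the goal is a decidable inequality or is itself doubly negated.
  ¬¬-DistS : ∀ {n} (U W : Subspace F n) → ¬ ¬ (∃ (DistS F U W))
  ¬¬-DistS U W none = ¬¬-HasDim (sumSub U W) λ (s , S) → ¬¬-HasDim (capSub U W) λ (i , C) →
    none (s ∸ i , s , i , S , C , ≡.refl)

  -- Distance between subspaces of equal dimension

  module _ {n t} (U W : Subspace F n) (U-dim : HasDim F (mem U) t) (W-dim : HasDim F (mem W) t) where
    private
      P : Param (U ∋_) (Fin t)
      P = HasDim⇒Param U U-dim
      R : Param (W ∋_) (Fin t)
      R = HasDim⇒Param W W-dim
      module P = Param P
      module R = Param R
      split : Linear (Fin (t ℕ.+ t)) (Fin t ⊎ Fin t)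
      split = reindex (join t t)
      unsplit : (x : Fn (Fin t ⊎ Fin t)) → app split (x ∘ splitAt t) ≋ x
      unsplit x k = reflexive (≡.cong x (Finₚ.splitAt-join t t k))

    ≅⇒DistS-0 : _≅_ F U W → DistS F U W 0
    ≅⇒DistS-0 U≅W = t , t , Param⇒HasDim (sumSub U W) sumP , Param⇒HasDim (capSub U W) capP , ≡.sym (ℕₚ.n∸n≡0 t)
      where
      sumP : Param (sumSub U W ∋_) (Fin t)
      sumP = record
        { φ = P.φ ; inj = P.inj
        ; into = λ x → ∋-sum⁺ U W (P.into x) (∋-0 W) (λ _ → sym (+-identityʳ _))
        ; onto = λ v∈ → let _ , _ , y∈ , z∈ , e = ∋-sum⁻ U W v∈ in
            P.onto (∋-resp U (λ i → sym (e i)) (∋-+ U y∈ (proj₂ (U≅W _) z∈)))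
        }
      capP : Param (capSub U W ∋_) (Fin t)
      capP = record
        { φ = P.φ ; inj = P.inj
        ; into = λ x → P.into x , proj₁ (U≅W _) (P.into x)
        ; onto = λ (v∈ , _) → P.onto v∈
        }

    module _ {s i} (S-dim : HasDim F (sumS F U W) s) (C-dim : HasDim F (capS F U W) i) where
      private
        S : Param (sumSub U W ∋_) (Fin s)
        S = HasDim⇒Param (sumSub U W) S-dim
        C : Param (capSub U W ∋_) (Fin i)
        C = HasDim⇒Param (capSub U W) C-dim
        module S = Param S
        module C = Param C

      -- `factor` provides a linear section of `U ⊕ W → U + W`, and a section is injective.
      sum-≤-2t : s ≤ t ℕ.+ t
      sum-≤-2t =
        let σ , e = factor s S.φ (sumL U W P R) (λ x → sumL-onto U W P R (S.into x))
        in injective⇒≤ (reindex (splitAt t) ∘L σ) λ x σx≋0 → S.inj x λ j →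
             trans (sym (e x j)) (≋0 (sumL U W P R) (λ k → trans (sym (unsplit (app σ x) k)) (σx≋0 (join t t k))) j)

      t-≤-sum : t ≤ s
      t-≤-sum = dim-mono P S λ x∈ → ∋-sum⁺ U W x∈ (∋-0 W) (λ _ → sym (+-identityʳ _))

      codim-bound : s ∸ i ≤ 2 ℕ.* (s ∸ t)
      codim-bound = s∸i≤2[s∸t] t-≤-sum (dim-sum-cap U W P R S C)

      sum-≤-n : s ≤ n
      sum-≤-n = dim-≤-ambient S

      cap-trivial-if : i ≡ 0 → ∀ {x} → capSub U W ∋ x → x ≋ 0f
      cap-trivial-if ≡.refl x∈ j = let y , e = C.onto x∈ in trans (sym (e j)) (≋0 C.φ {y} (λ ()) j)

      -- When `s ≡ n`, the coordinate map of the sum is an injective endomorphism of `F^n`, hence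
      -- surjective.
      sum-full-if : s ≡ n → ∀ x → sumSub U W ∋ x
      sum-full-if ≡.refl x = let y , e = endo-injective⇒surjective S.φ S.inj x in ∋-resp (sumSub U W) e (S.into y)

    DistS-≤-2t : ∀ {d} → DistS F U W d → d ≤ 2 ℕ.* t
    DistS-≤-2t (s , i , S , C , ≡.refl) = ℕₚ.≤-trans (ℕₚ.m∸n≤m s i)
      (ℕₚ.≤-trans (sum-≤-2t S C) (ℕₚ.≤-reflexive (m+m≡2*m t)))

    DistS-≤-2[n∸t] : ∀ {d} → DistS F U W d → d ≤ 2 ℕ.* (n ∸ t)
    DistS-≤-2[n∸t] (s , i , S , C , ≡.refl) = ℕₚ.≤-trans (codim-bound S C)
      (ℕₚ.*-monoʳ-≤ 2 (ℕₚ.∸-monoˡ-≤ t (sum-≤-n S C)))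

    dim-≤-n : t ≤ n
    dim-≤-n = dim-≤-ambient P

    maxDist⇒cap-trivial : 0 < t → ∀ {d} → DistS F U W d → 2 ℕ.* t ≤ d → ∀ {x} → capSub U W ∋ x → x ≋ 0f
    maxDist⇒cap-trivial 0<t (s , i , S , C , ≡.refl) 2t≤d =
      cap-trivial-if S C (2t≤s∸i⇒i≡0 0<t (sum-≤-2t S C) 2t≤d)

    -- The squeeze `2 * (n ∸ t) ≤ d ≤ 2 * (s ∸ t)` gives `n ≤ s`; removing the truncated subtraction
    -- is sound because `t ≤ s`.
    maxDist⇒sum-full : ∀ {d} → DistS F U W d → 2 ℕ.* (n ∸ t) ≤ d → ∀ x → sumSub U W ∋ x
    maxDist⇒sum-full (s , i , S , C , ≡.refl) 2[n-t]≤d =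
      sum-full-if S C (ℕₚ.≤-antisym (sum-≤-n S C)
        (∸-reflectsˡ-≤ (t-≤-sum S C)
           (ℕₚ.*-cancelˡ-≤ 2 (ℕₚ.≤-trans 2[n-t]≤d (codim-bound S C)))))

    -- A trivial intersection makes `sumL` injective, so the bases of `U` and `W` together form a
    -- basis of the sum.
    cap-trivial⇒DistS : (∀ {x} → capSub U W ∋ x → x ≋ 0f) → DistS F U W (2 ℕ.* t)
    cap-trivial⇒DistS trivial = t ℕ.+ t , 0 , Param⇒HasDim (sumSub U W) sumP , Param⇒HasDim (capSub U W) capP
      , ≡.sym (m+m≡2*m t)
      where
      sum-injective : Injective (sumL U W P R)
      sum-injective x e = λ { (inj₁ j) → left j ; (inj₂ j) → right j }
        where
        left : x ∘ inj₁ ≋ 0f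
        left = P.inj _ (trivial (kernel-∋-cap U W P R x e))
        right : x ∘ inj₂ ≋ 0f
        right = R.inj _ λ j → trans (sym (trans (+-congʳ (≋0 P.φ left j)) (+-identityˡ _))) (e j)
      sumP : Param (sumSub U W ∋_) (Fin (t ℕ.+ t))
      sumP = record
        { φ    = sumL U W P R ∘L split
        ; inj  = λ x e j → trans (reflexive (≡.cong x (≡.sym (Finₚ.join-splitAt t t j))))
                   (sum-injective (app split x) e (splitAt t j))
        ; into = λ x → sumL-∋ U W P R (app split x)
        ; onto = λ v∈ → let x , e = sumL-onto U W P R v∈ in
            x ∘ splitAt t , λ j → trans (resp≋ (sumL U W P R) (unsplit x) j) (e j)
        }
      capP : Param (capSub U W ∋_) (Fin 0)
      capP = record
        { φ    = zeroL
        ; inj  = λ _ _ ()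
        ; into = λ _ → ∋-0 (capSub U W)
        ; onto = λ v∈ → 0f , λ j → sym (trivial v∈ j)
        }

    -- The intersection is the kernel of the surjection U ⊕ W → V, hence free although no
    -- basis of it can be found by elimination with zero tests.
    sum-full⇒DistS : ¬ ¬ (∀ x → sumSub U W ∋ x) → DistS F U W (2 ℕ.* (n ∸ t))
    sum-full⇒DistS ¬¬full =
      let k , 2t≡n+k , surj , L = kernel-free n (sumL U W P R ∘L split) (¬¬-map surjective ¬¬full)
      in n , k , Param⇒HasDim (sumSub U W) (sumP surj) , Param⇒HasDim (capSub U W) (capP L)
         , 2[n∸t]≡n∸k dim-≤-n 2t≡n+k
      where
      surjective : (∀ x → sumSub U W ∋ x) → Surjective (sumL U W P R ∘L split)
      surjective full v = let x , e = sumL-onto U W P R (full v) in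
        x ∘ splitAt t , λ j → trans (resp≋ (sumL U W P R) (unsplit x) j) (e j)
      sumP : Surjective (sumL U W P R ∘L split) → Param (sumSub U W ∋_) (Fin n)
      sumP surj = record { φ = idL ; inj = λ _ e → e ; onto = λ {v} _ → v , λ _ → refl
        ; into = λ v → let x , e = surj v in ∋-resp (sumSub U W) e (sumL-∋ U W P R (app split x)) }
      capP : ∀ {k} → Param (λ x → app (sumL U W P R ∘L split) x ≋ 0f) (Fin k) → Param (capSub U W ∋_) (Fin k)
      capP {k} L = record
        { φ    = P.φ ∘L κ₁
        ; inj  = κ₁-inj
        ; into = λ x → kernel-∋-cap U W P R (app split (app L.φ x)) (L.into x)
        ; onto = onto′
        }
        where
        module L = Param L
        κ₁ κ₂ : Linear (Fin k) (Fin t)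
        κ₁ = reindex inj₁ ∘L split ∘L L.φ
        κ₂ = reindex inj₂ ∘L split ∘L L.φ
        κ₁-inj : Injective (P.φ ∘L κ₁)
        κ₁-inj x e = L.inj x λ j →
          trans (reflexive (≡.cong (app L.φ x) (≡.sym (Finₚ.join-splitAt t t j)))) (both (splitAt t j))
          where
          both : app split (app L.φ x) ≋ 0f
          both (inj₁ j) = P.inj (app κ₁ x) e j
          both (inj₂ j) = R.inj (app κ₂ x)
            (λ i → trans (sym (trans (+-congʳ (e i)) (+-identityˡ _))) (L.into x i)) j
        onto′ : ∀ {v} → capSub U W ∋ v → ∃ λ x → app (P.φ ∘L κ₁) x ≋ v
        onto′ {v} (v∈U , v∈W) =
          -- The pair of `v` and `-f v` is sent to zero by `sumL`, so it has kernel coordinates.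
          let y , φy≋v  = P.onto v∈U
              z , φz≋-v = R.onto (∋-neg W v∈W)
              x , e     = L.onto {[ y , z ]′ ∘ splitAt t} λ j → trans (resp≋ (sumL U W P R) (unsplit [ y , z ]′) j)
                            (trans (+-cong (φy≋v j) (φz≋-v j)) (-‿inverseʳ _))
          in x , λ j → trans (resp≋ P.φ (λ m → trans (e (join t t (inj₁ m))) (unsplit [ y , z ]′ (inj₁ m))) j) (φy≋v j)

-- Optimal terms and finite sums

optTerm-low : ∀ n t → 2 ℕ.* t ≤ n → optTerm n t ≡ t
optTerm-low n t 2t≤n with 2 ℕ.* t ℕ.≤? n
... | yes _    = ≡.refl
... | no  2t≰n = ⊥-elim (2t≰n 2t≤n)

-- At `2 * t ≡ n` the definition of `optTerm` takes its other branch, where `t` and `n ∸ t`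
-- coincide.
optTerm-high : ∀ n t → n ≤ 2 ℕ.* t → optTerm n t ≡ n ∸ t
optTerm-high n t n≤2t with 2 ℕ.* t ℕ.≤? n
... | no  _    = ≡.refl
... | yes 2t≤n = begin
  t             ≡⟨ ℕₚ.m+n∸m≡n t t ⟨
  t ℕ.+ t ∸ t   ≡⟨ ≡.cong (_∸ t) (≡.trans (m+m≡2*m t) (ℕₚ.≤-antisym 2t≤n n≤2t)) ⟩
  n ∸ t         ∎
  where open ≡.≡-Reasoning

optTerm-positive : ∀ {n t} → 0 < t → t < n → 0 < optTerm n t
optTerm-positive {n} {t} 0<t t<n with 2 ℕ.* t ℕ.≤? n
... | yes _ = 0<t
... | no  _ = ℕₚ.m<n⇒0<n∸m t<n

0<2* : ∀ {m} → 0 < m → 0 < 2 ℕ.* m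
0<2* {m} 0<m = ℕₚ.≤-trans 0<m (ℕₚ.m≤m+n m _)

ΣFin-cong : ∀ r {f g} → (∀ i → f i ≡ g i) → ΣFin r f ≡ ΣFin r g
ΣFin-cong zero    f≡g = ≡.refl
ΣFin-cong (suc r) f≡g = ≡.cong₂ ℕ._+_ (f≡g zero) (ΣFin-cong r (f≡g ∘ suc))

ΣFin-mono : ∀ r {f g} → (∀ i → f i ≤ g i) → ΣFin r f ≤ ΣFin r g
ΣFin-mono zero    f≤g = z≤n
ΣFin-mono (suc r) f≤g = ℕₚ.+-mono-≤ (f≤g zero) (ΣFin-mono r (f≤g ∘ suc))

-- Slack in one term cannot be made up by another, since no term exceeds its bound; so the rest of
-- the sum cancels.
ΣFin-tight : ∀ r {f g} → (∀ i → f i ≤ g i) → ΣFin r g ≤ ΣFin r f → ∀ i → g i ≤ f i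
ΣFin-tight (suc r) {f} {g} f≤g Σg≤Σf zero = ℕₚ.+-cancelʳ-≤ (ΣFin r (f ∘ suc)) _ _
  (ℕₚ.≤-trans (ℕₚ.+-monoʳ-≤ (g zero) (ΣFin-mono r (f≤g ∘ suc))) Σg≤Σf)
ΣFin-tight (suc r) {f} {g} f≤g Σg≤Σf (suc i) = ΣFin-tight r (f≤g ∘ suc)
  (ℕₚ.+-cancelˡ-≤ (f zero) _ _ (ℕₚ.≤-trans (ℕₚ.+-monoˡ-≤ _ (f≤g zero)) Σg≤Σf)) i

term≤ΣFin : ∀ r f i → f i ≤ ΣFin r f
term≤ΣFin (suc r) f zero    = ℕₚ.m≤m+n (f zero) _
term≤ΣFin (suc r) f (suc i) = ℕₚ.≤-trans (term≤ΣFin r (f ∘ suc) i) (ℕₚ.m≤n+m _ (f zero))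

*-distribˡ-ΣFin : ∀ k r f → k ℕ.* ΣFin r f ≡ ΣFin r (λ i → k ℕ.* f i)
*-distribˡ-ΣFin k zero    f = ℕₚ.*-zeroʳ k
*-distribˡ-ΣFin k (suc r) f = ≡.trans (ℕₚ.*-distribˡ-+ k (f zero) _)
  (≡.cong (k ℕ.* f zero ℕ.+_) (*-distribˡ-ΣFin k r (f ∘ suc)))

-- Finite search and lists of representatives

greatest : ∀ {p r} {P : Fin r → Set p} → (∀ i → Dec (P i)) → ∃ P → ∃ λ a → P a × ∀ i → P i → i Fin.≤ a
greatest {r = suc r} P? (i , Pi) with Finₚ.any? (P? ∘ suc)
... | yes tail with greatest (P? ∘ suc) tail
...   | a , Pa , max = suc a , Pa , λ { zero _ → z≤n ; (suc j) Pj → s≤s (max j Pj) }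
greatest {r = suc r} P? (zero  , P0) | no none = zero , P0 , λ { zero _ → z≤n ; (suc j) Pj → ⊥-elim (none (j , Pj)) }
greatest {r = suc r} P? (suc i , Pi) | no none = ⊥-elim (none (i , Pi))

least : ∀ {p r} {P : Fin r → Set p} → (∀ i → Dec (P i)) → ∃ P → ∃ λ b → P b × ∀ i → P i → b Fin.≤ i
least {r = suc r} P? (i , Pi) with P? zero
... | yes P0 = zero , P0 , λ _ _ → z≤n
least {r = suc r} P? (zero  , P0) | no ¬P0 = ⊥-elim (¬P0 P0)
least {r = suc r} P? (suc i , Pi) | no ¬P0 with least (P? ∘ suc) (i , Pi)
... | b , Pb , min = suc b , Pb , λ { zero P0 → ⊥-elim (¬P0 P0) ; (suc j) Pj → s≤s (min j Pj) }

AllPairs-lookup : ∀ {a ℓ} {A : Set a} {R : A → A → Set ℓ} {xs} → AllPairs R xs →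
                  ∀ {i j} → i Fin.< j → R (List.lookup xs i) (List.lookup xs j)
AllPairs-lookup (x∼ ∷ _)  {zero}  {suc j} _         = All.lookup x∼ (∈-lookup j)
AllPairs-lookup (_  ∷ ps) {suc i} {suc j} (s≤s i<j) = AllPairs-lookup ps i<j

AllPairs-map∈ : ∀ {a r s} {A : Set a} {R : A → A → Set r} {S : A → A → Set s} {xs} →
                (∀ {x y} → x ∈ xs → y ∈ xs → R x y → S x y) → AllPairs R xs → AllPairs S xs
AllPairs-map∈ f []        = []
AllPairs-map∈ f (x∼ ∷ ps) =
  All.tabulate (λ y∈ → f (here ≡.refl) (there y∈) (All.lookup x∼ y∈))
  ∷ AllPairs-map∈ (λ x∈ y∈ → f (there x∈) (there y∈)) ps

-- If two different positions p, q of L had equivalent images, the pairwise inequivalent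
-- representatives of the images would inject into the positions other than q.
module _ {a b e} {A : Set a} {B : Set b} (_~_ : B → B → Set e)
         (~-sym : ∀ {x y} → x ~ y → y ~ x) (~-trans : ∀ {x y z} → x ~ y → y ~ z → x ~ z)
         (f : A → B) where

  fullCard⇒injective : ∀ {L} → HasCard _~_ (List.map f L) (length L) →
                       ∀ {p q} → p ≢ q → ¬ f (List.lookup L p) ~ f (List.lookup L q)
  fullCard⇒injective {x ∷ L} (xs , len , xs⊆L , _ , distinct) {p} {q} p≢q p~q =
    -- `xs` is as long as `x ∷ L`, one more than the number of positions other than `q`, onto which
    -- `punchOut` renumbers.
    let k , l , k<l , eq = Finₚ.pigeonhole (ℕₚ.≤-reflexive (≡.sym len)) λ k → Fin.punchOut (avoid k)
    in AllPairs-lookup distinct k<l (~-trans (avoid-~ k)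
         (~-sym (≡.subst (λ i → List.lookup xs l ~ f (List.lookup (x ∷ L) i))
           (≡.sym (Finₚ.punchOut-injective (avoid k) (avoid l) eq)) (avoid-~ l))))
    where
    image : ∀ k → Any (λ y → List.lookup xs k ~ f y) (x ∷ L)
    image k = Anyₚ.map⁻ (All.lookup xs⊆L (∈-lookup k))
    redirected : ∀ k → ∃ λ i → q ≢ i × (List.lookup xs k ~ f (List.lookup (x ∷ L) i))
    redirected k with q Finₚ.≟ Any.index (image k)
    ... | no  q≢i = _ , q≢i , Anyₚ.lookup-index (image k)
    ... | yes q≡i = p , (λ q≡p → p≢q (≡.sym q≡p)) , ~-trans
      (≡.subst (λ i → List.lookup xs k ~ f (List.lookup (x ∷ L) i)) (≡.sym q≡i) (Anyₚ.lookup-index (image k)))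
      (~-sym p~q)
    avoid : ∀ k → q ≢ proj₁ (redirected k)
    avoid k = proj₁ (proj₂ (redirected k))
    avoid-~ : ∀ k → List.lookup xs k ~ f (List.lookup (x ∷ L) (proj₁ (redirected k)))
    avoid-~ k = proj₂ (proj₂ (redirected k))

-- Flag codes and their projections

module FlagCodes {c ℓ : Level} (F : FiniteField c ℓ) (n r : ℕ) (t : Fin r → ℕ)
                 (type : IsType n r t) (C : List (Flag F n r t)) (isCode : IsFlagCode F C) where
  open LinearAlgebra F

  private
    0<t : ∀ i → 0 < t i
    0<t = proj₁ type
    t<n : ∀ i → t i < n
    t<n = proj₁ (proj₂ type)
    opt : ℕ
    opt = optDist n r t
    optᵢ : Fin r → ℕ
    optᵢ i = 2 ℕ.* optTerm n (t i)

    opt≡Σ : opt ≡ ΣFin r optᵢ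
    opt≡Σ = *-distribˡ-ΣFin 2 r (λ i → optTerm n (t i))

  optᵢ-positive : ∀ i → 0 < optᵢ i
  optᵢ-positive i = 0<2* (optTerm-positive (0<t i) (t<n i))

  opt-positive : Fin r → 0 < opt
  opt-positive i = 0<2* (ℕₚ.≤-trans (optTerm-positive (0<t i) (t<n i)) (term≤ΣFin r _ i))

  ≅-sym : ∀ (U W : Subspace F n) → _≅_ F U W → _≅_ F W U
  ≅-sym _ _ e v = proj₂ (e v) , proj₁ (e v)

  ≅-trans : ∀ (U W X : Subspace F n) → _≅_ F U W → _≅_ F W X → _≅_ F U X
  ≅-trans _ _ _ e e′ v = proj₁ (e′ v) ∘ proj₁ (e v) , proj₂ (e v) ∘ proj₂ (e′ v)

  ≅-refl : ∀ {U : Subspace F n} → _≅_ F U U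
  ≅-refl v = id , id

  ∈-proj⁻ : ∀ {i U} → U ∈ proj F C i → ∃ λ Φ → Φ ∈ C × U ≡ sub Φ i
  ∈-proj⁻ = ∈-map⁻ _

  projIsCDC : ∀ i → IsCDC F (proj F C i) (t i)
  projIsCDC i = (λ e → proj₁ isCode (map-[] C e)) , Allₚ.map⁺ (All.universal (λ Φ → dim Φ i) C)
    where
    map-[] : ∀ L → proj F L i ≡ [] → L ≡ []
    map-[] [] _ = ≡.refl

  optᵢ-low : ∀ i → 2 ℕ.* t i ≤ n → optᵢ i ≡ 2 ℕ.* t i
  optᵢ-low i 2t≤n = ≡.cong (2 ℕ.*_) (optTerm-low n (t i) 2t≤n)

  optᵢ-high : ∀ i → n ≤ 2 ℕ.* t i → optᵢ i ≡ 2 ℕ.* (n ∸ t i)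
  optᵢ-high i n≤2t = ≡.cong (2 ℕ.*_) (optTerm-high n (t i) n≤2t)

  DistS-≤-optᵢ : ∀ (Φ Ψ : Flag F n r t) i {d} → DistS F (sub Φ i) (sub Ψ i) d → d ≤ optᵢ i
  DistS-≤-optᵢ Φ Ψ i {d} D =
    [ (λ 2t≤n → ≡.subst (d ≤_) (≡.sym (optᵢ-low i 2t≤n)) (DistS-≤-2t (sub Φ i) (sub Ψ i) (dim Φ i) (dim Ψ i) D))
    , (λ n≤2t → ≡.subst (d ≤_) (≡.sym (optᵢ-high i n≤2t)) (DistS-≤-2[n∸t] (sub Φ i) (sub Ψ i) (dim Φ i) (dim Ψ i) D))
    ]′ (ℕₚ.≤-total (2 ℕ.* t i) n)

  FlagDist-unique : ∀ (Φ Ψ : Flag F n r t) {d d′} → FlagDist F Φ Ψ d → FlagDist F Φ Ψ d′ → d ≡ d′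
  FlagDist-unique Φ Ψ (ds , D , ≡.refl) (ds′ , D′ , ≡.refl) =
    ΣFin-cong r (λ i → DistS-unique (sub Φ i) (sub Ψ i) (D i) (D′ i))

  optimalFlagDist⇒optimalDistS : ∀ (Φ Ψ : Flag F n r t) {d} → FlagDist F Φ Ψ d → opt ≤ d →
                                 ∀ i → DistS F (sub Φ i) (sub Ψ i) (optᵢ i)
  optimalFlagDist⇒optimalDistS Φ Ψ (ds , D , ≡.refl) opt≤d i =
    ≡.subst (DistS F (sub Φ i) (sub Ψ i))
      (ℕₚ.≤-antisym (bound i) (ΣFin-tight r bound (≡.subst (_≤ ΣFin r ds) opt≡Σ opt≤d) i)) (D i)
    where
    bound : ∀ i → ds i ≤ optᵢ i
    bound i = DistS-≤-optᵢ Φ Ψ i (D i)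

  -- From optimum distance to the projected codes

  module _ (odfc : IsODFC F n r t C) where

    -- The code hypothesis speaks of whole flag distances, while a distance is given at one index
    -- only. Those at all indices may be assumed because the goal is a stable inequality; uniqueness
    -- then identifies the one at `i` with `d`.
    distinct⇒optᵢ≤DistS : ∀ {Φ Ψ} → Φ ∈ C → Ψ ∈ C → ¬ FlagEq F Φ Ψ →
                          ∀ i {d} → DistS F (sub Φ i) (sub Ψ i) d → optᵢ i ≤ d
    distinct⇒optᵢ≤DistS {Φ} {Ψ} Φ∈ Ψ∈ Φ≠Ψ i {d} D = decidable-stable (optᵢ i ℕ.≤? d) λ optᵢ≰d →
      ¬¬-all (λ j → ¬¬-DistS (sub Φ j) (sub Ψ j)) λ dists →
        let flagDist = proj₁ ∘ dists , proj₂ ∘ dists , ≡.refl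
        in optᵢ≰d (ℕₚ.≤-reflexive (DistS-unique (sub Φ i) (sub Ψ i)
             (optimalFlagDist⇒optimalDistS Φ Ψ flagDist (proj₁ odfc Φ∈ Ψ∈ Φ≠Ψ _ flagDist) i) D))

    -- Equal components would be at distance 0, below the positive `optᵢ i`. This is why projecting
    -- loses no flags.
    distinct⇒≇ : ∀ {Φ Ψ} → Φ ∈ C → Ψ ∈ C → ¬ FlagEq F Φ Ψ → ∀ i → ¬ _≅_ F (sub Φ i) (sub Ψ i)
    distinct⇒≇ {Φ} {Ψ} Φ∈ Ψ∈ Φ≠Ψ i Φᵢ≅Ψᵢ = ℕₚ.<⇒≱ (optᵢ-positive i)
      (distinct⇒optᵢ≤DistS Φ∈ Ψ∈ Φ≠Ψ i (≅⇒DistS-0 (sub Φ i) (sub Ψ i) (dim Φ i) (dim Ψ i) Φᵢ≅Ψᵢ))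

    projMinDist : ∀ i → MinDist (_≅_ F) (DistS F) (proj F C i) (optᵢ i)
    projMinDist i = lower , inj₂ attained
      where
      lower : ∀ {U W} → U ∈ proj F C i → W ∈ proj F C i → ¬ _≅_ F U W → ∀ d → DistS F U W d → optᵢ i ≤ d
      lower U∈ W∈ U≇W d D with ∈-proj⁻ U∈ | ∈-proj⁻ W∈
      ... | Φ , Φ∈ , ≡.refl | Ψ , Ψ∈ , ≡.refl = distinct⇒optᵢ≤DistS Φ∈ Ψ∈ (λ e → U≇W (e i)) i D
      attained : ∃₂ λ U W → U ∈ proj F C i × W ∈ proj F C i × ¬ _≅_ F U W × DistS F U W (optᵢ i)
      attained with proj₂ odfc
      -- The convention for one-element codes would make `opt` zero, but its summand at `i` is
      -- positive.
      ... | inj₁ (_ , opt≡0) = ⊥-elim (ℕₚ.<⇒≢ (opt-positive i) (≡.sym opt≡0))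
      ... | inj₂ (Φ , Ψ , Φ∈ , Ψ∈ , Φ≠Ψ , D) = sub Φ i , sub Ψ i , ∈-map⁺ _ Φ∈ , ∈-map⁺ _ Ψ∈ ,
        distinct⇒≇ Φ∈ Ψ∈ Φ≠Ψ i , optimalFlagDist⇒optimalDistS Φ Ψ D ℕₚ.≤-refl i

    projMaxDist : ∀ i → MaxDistCDC F n (proj F C i) (t i)
    projMaxDist i =
        (λ 2t≤n → ≡.subst (MinDist (_≅_ F) (DistS F) (proj F C i)) (optᵢ-low i 2t≤n) (projMinDist i))
      , (λ n≤2t → ≡.subst (MinDist (_≅_ F) (DistS F) (proj F C i)) (optᵢ-high i n≤2t) (projMinDist i))

    projHasCard : ∀ i → HasCard (_≅_ F) (proj F C i) (length C)
    projHasCard i = proj F C i , Listₚ.length-map _ C , reflexive , reflexive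
      , AllPairsₚ.map⁺ (AllPairs-map∈ (λ Φ∈ Ψ∈ Φ≠Ψ → distinct⇒≇ Φ∈ Ψ∈ Φ≠Ψ i) (proj₂ isCode))
      where
      reflexive : All (λ U → Any (_≅_ F U) (proj F C i)) (proj F C i)
      reflexive = All.tabulate (Any.map λ { {U} ≡.refl → ≅-refl {U} })

  -- From the projected codes to optimum distance

  sub-mono : ∀ (Φ : Flag F n r t) {i j} → i Fin.≤ j → _⊆_ F (sub Φ i) (sub Φ j)
  sub-mono Φ {i} {j} i≤j with i Finₚ.≟ j
  ... | yes ≡.refl = λ _ → id
  ... | no  i≢j    = proj₁ (chain Φ i j (Finₚ.≤∧≢⇒< i≤j i≢j))

  MaxDistProj : Fin r → Set _
  MaxDistProj i = IsCDC F (proj F C i) (t i) × MaxDistCDC F n (proj F C i) (t i)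
                × HasCard (_≅_ F) (proj F C i) (length C)

  -- Membership proofs determine positions in `C`. Flags that differ sit at different positions, to
  -- which `fullCard⇒injective` applies.
  fullCard⇒≇ : ∀ i → HasCard (_≅_ F) (proj F C i) (length C) →
               ∀ {Φ Ψ} → Φ ∈ C → Ψ ∈ C → ¬ FlagEq F Φ Ψ → ¬ _≅_ F (sub Φ i) (sub Ψ i)
  fullCard⇒≇ i card {Φ} {Ψ} Φ∈ Ψ∈ Φ≠Ψ Φᵢ≅Ψᵢ =
    fullCard⇒injective (_≅_ F) (λ {U} {W} → ≅-sym U W) (λ {U} {W} {X} → ≅-trans U W X) (λ Φ → sub Φ i) card
      {Any.index Φ∈} {Any.index Ψ∈}
      (λ p≡q → Φ≠Ψ (≡⇒FlagEq (≡.trans Φ≡ (≡.trans (≡.cong (List.lookup C) p≡q) (≡.sym Ψ≡)))))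
      (≡.subst₂ (λ Φ Ψ → _≅_ F (sub Φ i) (sub Ψ i)) Φ≡ Ψ≡ Φᵢ≅Ψᵢ)
    where
    Φ≡ : Φ ≡ List.lookup C (Any.index Φ∈)
    Φ≡ = Anyₚ.lookup-index Φ∈
    Ψ≡ : Ψ ≡ List.lookup C (Any.index Ψ∈)
    Ψ≡ = Anyₚ.lookup-index Ψ∈
    ≡⇒FlagEq : ∀ {Φ Ψ} → Φ ≡ Ψ → FlagEq F Φ Ψ
    ≡⇒FlagEq {Φ} ≡.refl i = ≅-refl {sub Φ i}

  module _ (atMaxLe : ∀ a → IsMaxLe n r t a → MaxDistProj a)
           (atMinGe : ∀ b → IsMinGe n r t b → MaxDistProj b) where

    maxLe : ∀ i → 2 ℕ.* t i ≤ n → ∃ (IsMaxLe n r t)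
    maxLe i 2t≤n = greatest (λ i → 2 ℕ.* t i ℕ.≤? n) (i , 2t≤n)

    minGe : ∀ i → n ≤ 2 ℕ.* t i → ∃ (IsMinGe n r t)
    minGe i n≤2t = least (λ i → n ℕ.≤? 2 ℕ.* t i) (i , n≤2t)

    module _ {Φ Ψ} (Φ∈ : Φ ∈ C) (Ψ∈ : Ψ ∈ C) (Φ≠Ψ : ¬ FlagEq F Φ Ψ) where

      -- A distance at `a` is demanded as input: the equations `x ≋ 0f` drawn from it are not
      -- assumed to be ¬¬-stable, so a distance known only up to double negation would not do.
      lowDistS : ∀ a → IsMaxLe n r t a → ∀ {d} → DistS F (sub Φ a) (sub Ψ a) d →
                 ∀ i → 2 ℕ.* t i ≤ n → DistS F (sub Φ i) (sub Ψ i) (2 ℕ.* t i)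
      lowDistS a max {d} D i 2t≤n =
        let _ , maxDist , card = atMaxLe a max
            2tₐ≤d = proj₁ (proj₁ maxDist (proj₁ max)) (∈-map⁺ _ Φ∈) (∈-map⁺ _ Ψ∈) (fullCard⇒≇ a card Φ∈ Ψ∈ Φ≠Ψ) d D
            i≤a   = proj₂ max i 2t≤n
        in cap-trivial⇒DistS (sub Φ i) (sub Ψ i) (dim Φ i) (dim Ψ i) λ (x∈Φ , x∈Ψ) →
             maxDist⇒cap-trivial (sub Φ a) (sub Ψ a) (dim Φ a) (dim Ψ a) (0<t a) D 2tₐ≤d
               (sub-mono Φ i≤a _ x∈Φ , sub-mono Ψ i≤a _ x∈Ψ)

      -- Fullness of the sum at `b` is obtained only up to double negation, and `sum-full⇒DistS`
      -- absorbs it; so no distance has to be supplied.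
      highDistS : ∀ i → n ≤ 2 ℕ.* t i → DistS F (sub Φ i) (sub Ψ i) (2 ℕ.* (n ∸ t i))
      highDistS i n≤2t =
        let b , min = minGe i n≤2t
            _ , maxDist , card = atMinGe b min
            b≤i = proj₂ min i n≤2t
        in sum-full⇒DistS (sub Φ i) (sub Ψ i) (dim Φ i) (dim Ψ i) (¬¬-map (λ (d , D) x →
             let y , z , y∈ , z∈ , e = maxDist⇒sum-full (sub Φ b) (sub Ψ b) (dim Φ b) (dim Ψ b) D
                   (proj₁ (proj₂ maxDist (proj₁ min)) (∈-map⁺ _ Φ∈) (∈-map⁺ _ Ψ∈) (fullCard⇒≇ b card Φ∈ Ψ∈ Φ≠Ψ) d D) x
             in y , z , sub-mono Φ b≤i _ y∈ , sub-mono Ψ b≤i _ z∈ , e)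
             (¬¬-DistS (sub Φ b) (sub Ψ b)))

      -- The input is a function of `a` because there may be no index with `2 * t i ≤ n`; all
      -- indices above the middle are served by `highDistS`.
      optimalFlagDist : (∀ a → IsMaxLe n r t a → ∃ (DistS F (sub Φ a) (sub Ψ a))) → FlagDist F Φ Ψ opt
      optimalFlagDist distₐ = optᵢ , dists , opt≡Σ
        where
        dists : ∀ i → DistS F (sub Φ i) (sub Ψ i) (optᵢ i)
        dists i =
          [ (λ 2t≤n → let a , max = maxLe i 2t≤n in
               ≡.subst (DistS F (sub Φ i) (sub Ψ i)) (≡.sym (optᵢ-low i 2t≤n))
                 (lowDistS a max (proj₂ (distₐ a max)) i 2t≤n))
          , (λ n≤2t → ≡.subst (DistS F (sub Φ i) (sub Ψ i)) (≡.sym (optᵢ-high i n≤2t)) (highDistS i n≤2t))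
          ]′ (ℕₚ.≤-total (2 ℕ.* t i) n)

    proj-attains : ∀ i {d} → 0 < d → MinDist (_≅_ F) (DistS F) (proj F C i) d →
                   ∃₂ λ Φ Ψ → Φ ∈ C × Ψ ∈ C × ¬ FlagEq F Φ Ψ × DistS F (sub Φ i) (sub Ψ i) d
    proj-attains i 0<d (_ , inj₁ (_ , d≡0)) = ⊥-elim (ℕₚ.<⇒≢ 0<d (≡.sym d≡0))
    proj-attains i 0<d (_ , inj₂ (U , W , U∈ , W∈ , U≇W , D)) with ∈-proj⁻ U∈ | ∈-proj⁻ W∈
    ... | Φ , Φ∈ , ≡.refl | Ψ , Ψ∈ , ≡.refl = Φ , Ψ , Φ∈ , Ψ∈ , (λ e → U≇W (e i)) , D

    -- A pair attaining the minimum distance of the projected code at `a` brings the explicit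
    -- distance that `optimalFlagDist` asks for. If there is no such `a`, the index `i₀` guarantees
    -- that `b` exists and a pair attaining the minimum there is taken.
    attained : Fin r → ∃₂ λ Φ Ψ → Φ ∈ C × Ψ ∈ C × ¬ FlagEq F Φ Ψ × FlagDist F Φ Ψ opt
    attained i₀ with Finₚ.any? (λ i → 2 ℕ.* t i ℕ.≤? n)
    ... | yes (i , 2t≤n) =
      let a , max                  = maxLe i 2t≤n
          _ , maxDist , _          = atMaxLe a max
          Φ , Ψ , Φ∈ , Ψ∈ , Φ≠Ψ , D = proj-attains a (0<2* (0<t a)) (proj₁ maxDist (proj₁ max))
      in Φ , Ψ , Φ∈ , Ψ∈ , Φ≠Ψ , optimalFlagDist Φ∈ Ψ∈ Φ≠Ψ λ a′ max′ →
           ≡.subst (λ a → ∃ (DistS F (sub Φ a) (sub Ψ a)))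
             (Finₚ.≤-antisym (proj₂ max′ a (proj₁ max)) (proj₂ max a′ (proj₁ max′))) (_ , D)
    ... | no none =
      let b , min                  = minGe i₀ (ℕₚ.≰⇒≥ λ 2t≤n → none (i₀ , 2t≤n))
          _ , maxDist , _          = atMinGe b min
          Φ , Ψ , Φ∈ , Ψ∈ , Φ≠Ψ , D = proj-attains b (0<2* (ℕₚ.m<n⇒0<n∸m (t<n b))) (proj₂ maxDist (proj₁ min))
      in Φ , Ψ , Φ∈ , Ψ∈ , Φ≠Ψ , optimalFlagDist Φ∈ Ψ∈ Φ≠Ψ λ a max → ⊥-elim (none (a , proj₁ max))

    maxDistProj⇒ODFC : Fin r → IsODFC F n r t C
    maxDistProj⇒ODFC i₀ = lower , inj₂ (attained i₀)
      where
      lower : ∀ {Φ Ψ} → Φ ∈ C → Ψ ∈ C → ¬ FlagEq F Φ Ψ → ∀ d → FlagDist F Φ Ψ d → opt ≤ d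
      -- The given flag distance contains a distance at `a`, which makes `opt` a flag distance of
      -- the same pair; uniqueness identifies the two.
      lower {Φ} {Ψ} Φ∈ Ψ∈ Φ≠Ψ d D@(ds , DS , _) = ℕₚ.≤-reflexive
        (FlagDist-unique Φ Ψ (optimalFlagDist Φ∈ Ψ∈ Φ≠Ψ (λ a _ → ds a , DS a)) D)

theorem4p8 : {c ℓ : Level} (F : FiniteField c ℓ) (n r : ℕ) (t : Fin r → ℕ)
    → 1 ≤ r → IsType n r t
    → (C : List (Flag F n r t)) → IsFlagCode F C
    → IsODFC F n r t C
    ⇔ ( (∀ a → IsMaxLe n r t a →
    IsCDC F (proj F C a) (t a) × MaxDistCDC F n (proj F C a) (t a)
    × HasCard (_≅_ F) (proj F C a) (length C))
    × (∀ b → IsMinGe n r t b →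
    IsCDC F (proj F C b) (t b) × MaxDistCDC F n (proj F C b) (t b)
    × HasCard (_≅_ F) (proj F C b) (length C)) )
theorem4p8 F n (suc r) t 1≤r type C isCode = mk⇔
  (λ odfc → (λ a _ → projIsCDC a , projMaxDist odfc a , projHasCard odfc a)
          , (λ b _ → projIsCDC b , projMaxDist odfc b , projHasCard odfc b))
  (λ (atMaxLe , atMinGe) → maxDistProj⇒ODFC atMaxLe atMinGe zero)
  where open FlagCodes F n (suc r) t type C isCode
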